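{- For any $n\ge1$, $$\sum_{\pi\in\mathfrak{S}_n(321)}t^{\mathsf{wex}\,\pi}q^{\mathsf{inv}\,\pi}=\sum_{k=1}^{\lfloor (n+1)/2\rfloor}\Big(q^{n-k}\sum_{\pi\in\widetilde{\mathfrak{S}}_{n,k-1}(231)}q^{(13\text{ - }2)\pi}\Big)t^k(1+t/q)^{n+1-2k}.$$
   Context: $\mathfrak{S}_n(\tau)$: permutations of $[n]$ avoiding classical pattern $\tau$. $\mathsf{wex}\,\pi=\#\{i:\pi(i)\ge i\}$, $\mathsf{inv}\,\pi=\#\{i<j:\pi(i)>\pi(j)\}$, $\mathsf{des}\,\pi=\#\{i\in[n-1]:\pi(i)>\pi(i+1)\}$, $(13\text{ - }2)\pi=\#\{(i,j):i+1<j\le n,\pi(i)<\pi(j)<\pi(i+1)\}$. $\mathsf{dd}^*\,\pi$ is the number of $i\in[n]$ with $\pi(i-1)>\pi(i)>\pi(i+1)$ under boundary $\pi(0)=\pi(n+1)=n+1$. $\widetilde{\mathfrak{S}}_{n,k}(231)=\{\pi\in\mathfrak{S}_n(231):\mathsf{dd}^*\,\pi=0,\ \mathsf{des}\,\pi=k\}$. -}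

module Defs where

open import Algebra.Bundles using (CommutativeRing)
open import Data.Fin.Base using (Fin; toℕ) renaming (_<_ to _<ᶠ_)
open import Data.Fin.Patterns using (0F; 1F; 2F)
import Data.Fin.Properties as Fin
open import Data.List.Base using (List; []; _∷_; allFin; applyUpTo; cartesianProduct; cartesianProductWith; filter; foldr; length; map)
open import Data.List.Membership.Propositional using (_∈_; lose)
open import Data.List.Membership.Propositional.Properties using (∈-allFin; ∈-cartesianProductWith⁺)
open import Data.List.Relation.Unary.All using () renaming ([] to []ᴬ)
open import Data.List.Relation.Unary.AllPairs using () renaming ([] to []ᴾ; _∷_ to _∷ᴾ_)
open import Data.List.Relation.Unary.Any using (here; any?; satisfied)
import Data.List.Relation.Unary.Unique.Propositional as List
import Data.List.Relation.Unary.Unique.Propositional.Properties as List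
open import Data.Nat.Base using (ℕ; zero; suc; _+_; _∸_)
open import Data.Nat.Properties using (_<?_; _≤?_; _≟_)
open import Data.Product.Base using (∃; _×_; _,_)
open import Data.Vec.Base using (Vec; []; _∷_; lookup)
open import Data.Vec.Properties using (∷-injective)
open import Data.Vec.Relation.Unary.AllPairs using (allPairs?)
open import Relation.Binary.PropositionalEquality.Core using (refl)
open import Relation.Nullary.Decidable using (¬?; map′; _×-dec_; _→-dec_)
open import Relation.Nullary.Negation.Core using (¬_)
open import Relation.Unary using (Pred; Decidable)

count : ∀ {a p} {A : Set a} {P : Pred A p} → Decidable P → List A → ℕ
count P? xs = length (filter P? xs)

words : (m l : ℕ) → List (Vec (Fin m) l)
words m zero    = [] ∷ []
words m (suc l) = cartesianProductWith _∷_ (allFin m) (words m l)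

words-complete : ∀ {m l} (w : Vec (Fin m) l) → w ∈ words m l
words-complete []      = here refl
words-complete (x ∷ w) = ∈-cartesianProductWith⁺ _∷_ (∈-allFin x) (words-complete w)

words-unique : ∀ m l → List.Unique (words m l)
words-unique m zero    = []ᴬ ∷ᴾ []ᴾ
words-unique m (suc l) =
  List.cartesianProductWith⁺ _∷_ ∷-injective (List.allFin⁺ m) (words-unique m l)

-- A permutation of [n] is given by its one-line notation, a word of length n
-- over Fin n without repeated letters; the letter x stands for toℕ x + 1.
permutations : (n : ℕ) → List (Vec (Fin n) n)
permutations n = filter (allPairs? (λ x y → ¬? (x Fin.≟ y))) (words n n)

-- The letters of π at the positions listed in v form a subsequence of π
-- that is order-isomorphic to τ.
Occurrence : ∀ {m n} → Vec (Fin m) m → Vec (Fin n) n → Vec (Fin n) m → Set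
Occurrence {m} τ π v =
  (∀ (a b : Fin m) → a <ᶠ b → lookup v a <ᶠ lookup v b) ×
  (∀ (a b : Fin m) →
    (lookup τ a <ᶠ lookup τ b → lookup π (lookup v a) <ᶠ lookup π (lookup v b)) ×
    (lookup π (lookup v a) <ᶠ lookup π (lookup v b) → lookup τ a <ᶠ lookup τ b))

occurrence? : ∀ {m n} (τ : Vec (Fin m) m) (π : Vec (Fin n) n) → Decidable (Occurrence τ π)
occurrence? τ π v =
  Fin.all? (λ a → Fin.all? λ b → (a Fin.<? b) →-dec (lookup v a Fin.<? lookup v b)) ×-dec
  Fin.all? (λ a → Fin.all? λ b →
    let τ? = lookup τ a Fin.<? lookup τ b
        π? = lookup π (lookup v a) Fin.<? lookup π (lookup v b)
    in (τ? →-dec π?) ×-dec (π? →-dec τ?))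

Avoids : ∀ {m n} → Vec (Fin m) m → Vec (Fin n) n → Set
Avoids τ π = ¬ (∃ λ v → Occurrence τ π v)

avoids? : ∀ {m n} (τ : Vec (Fin m) m) → Decidable (Avoids {m} {n} τ)
avoids? {m} {n} τ π =
  ¬? (map′ satisfied (λ (v , o) → lose (words-complete v) o)
           (any? (occurrence? τ π) (words n m)))

𝔖 : ∀ {m} (n : ℕ) → Vec (Fin m) m → List (Vec (Fin n) n)
𝔖 n τ = filter (avoids? τ) (permutations n)

p321 p231 : Vec (Fin 3) 3
p321 = 2F ∷ 1F ∷ 0F ∷ []
p231 = 1F ∷ 2F ∷ 0F ∷ []

[1⋯_] : ℕ → List ℕ
[1⋯ n ] = applyUpTo suc n

letter : ∀ {m l} → Vec (Fin m) l → ℕ → ℕ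
letter {m} []  _       = suc m
letter (x ∷ w) zero    = suc (toℕ x)
letter (x ∷ w) (suc i) = letter w i

-- π ⟨ i ⟩ is the value π(i), with positions and values both in 1, …, n, and
-- with the boundary convention π(0) = π(n+1) = n+1.
_⟨_⟩ : ∀ {n} → Vec (Fin n) n → ℕ → ℕ
_⟨_⟩ {n} π zero = suc n
π ⟨ suc i ⟩     = letter π i

module _ {n : ℕ} (π : Vec (Fin n) n) where

  wex : ℕ
  wex = count (λ i → i ≤? π ⟨ i ⟩) [1⋯ n ]

  inv : ℕ
  inv = count (λ (i , j) → (i <? j) ×-dec (π ⟨ j ⟩ <? π ⟨ i ⟩))
              (cartesianProduct [1⋯ n ] [1⋯ n ])

  des : ℕ
  des = count (λ i → π ⟨ i + 1 ⟩ <? π ⟨ i ⟩) [1⋯ n ∸ 1 ]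

  -- The statistic (13-2).
  vinc13-2 : ℕ
  vinc13-2 = count (λ (i , j) → (i + 1 <? j) ×-dec
                                (π ⟨ i ⟩ <? π ⟨ j ⟩) ×-dec (π ⟨ j ⟩ <? π ⟨ i + 1 ⟩))
                   (cartesianProduct [1⋯ n ] [1⋯ n ])

  dd* : ℕ
  dd* = count (λ i → (π ⟨ i ⟩ <? π ⟨ i ∸ 1 ⟩) ×-dec (π ⟨ i + 1 ⟩ <? π ⟨ i ⟩)) [1⋯ n ]

𝔖~231 : (n k : ℕ) → List (Vec (Fin n) n)
𝔖~231 n k = filter (λ π → (dd* π ≟ 0) ×-dec (des π ≟ k)) (𝔖 n p231)

module SumsAndPowers {c ℓ} (R : CommutativeRing c ℓ) where
  open CommutativeRing R using (Carrier; 0#; semiring) renaming (_+_ to _+ᴿ_)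
  open import Algebra.Properties.Semiring.Exp semiring public using (_^_)

  ∑ : ∀ {a} {A : Set a} → List A → (A → Carrier) → Carrier
  ∑ xs f = foldr _+ᴿ_ 0# (map f xs)

{-# OPTIONS --safe #-}
module Submission where

-- Both sides, as sequences in n, satisfy the recurrence
--   r₁ = t,  rₙ₊₁ = (q + t) rₙ + Σ_{a+b=n, a,b≥1} q^{b+1} rₐ r_b.
--
-- Right-hand side: after clearing denominators a permutation π with d descents has weight
-- t^{d+1} q^d (q + t)^{n-1-2d} q^{(13-2)π}.  A 231-avoiding permutation is v·max·w with every letter
-- of v below every letter of w, and without double descents v is nonempty; the ascent from v to the
-- maximum contributes |w| to (13-2), and everything else is additive.
--
-- Left-hand side: in a 321-avoiding permutation the weak excedances are the left-to-right maxima
-- (records), and a letter that is not a record is the smallest letter still missing.  Reading from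
-- left to right and remembering only the number h of missing letters below the current record gives a
-- linear recursion F in h.  Against the elementary symmetric polynomials eₖ(1, q, …, q^{h-1}) this
-- recursion becomes tridiagonal, so that F counts Motzkin paths on which raising a path by one level
-- multiplies the weight of every step by q.  Cutting such a path at its last visit to level 0 gives the
-- recurrence.

open import Defs
open import Algebra.Bundles using (CommutativeRing)
open import Data.Bool.Base using (Bool; true; false; _∧_; if_then_else_)
open import Data.Fin.Base using (Fin; toℕ; fromℕ<) renaming (zero to fzero; suc to fsuc; _<_ to _<ᶠ_)
open import Data.Fin.Patterns using (0F; 1F; 2F)
open import Data.Fin.Properties using (toℕ<n; toℕ-injective; injective⇒≤; fromℕ<-injective) renaming (_≟_ to _≟ᶠ_; <-cmp to <ᶠ-cmp)
open import Data.List.Base as List using (List; []; _∷_; _++_; map; length; upTo; applyUpTo; tabulate; allFin; filter; cartesianProduct; cartesianProductWith)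
open import Data.List.Membership.Propositional using (_∈_)
open import Data.List.Membership.Propositional.Properties using (∈-map⁻; ∈-upTo⁻; ∈-cartesianProductWith⁻; ∈-lookup)
open import Data.List.Properties using (length-++; length-upTo; length-map; map-id; map-applyUpTo; filter-++)
open import Data.List.Relation.Unary.All as All using (All; []; _∷_; all?)
import Data.List.Relation.Unary.All.Properties as All
open import Data.List.Relation.Unary.AllPairs as AllPairs using (AllPairs; []; _∷_)
import Data.List.Relation.Unary.AllPairs.Properties as AllPairs
open import Data.List.Relation.Unary.Any using (here; there)
open import Data.List.Relation.Unary.Unique.Propositional using (Unique)
import Data.List.Relation.Unary.Unique.Propositional.Properties as Unique
open import Data.Nat.Base using (ℕ; zero; suc; _≤_; _<_; z≤n; s≤s; _∸_; _<ᵇ_; ⌊_/2⌋) renaming (_+_ to _+ℕ_; _*_ to _*ℕ_)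
open import Data.Nat.Induction using (<-rec)
import Data.Nat.Properties as ℕ
open import Data.Nat.Tactic.RingSolver using (solve-∀)
open import Data.Product.Base using (_×_; _,_; proj₁; proj₂; ∃; map₁)
open import Data.Sum.Base using (_⊎_; inj₁; inj₂)
open import Data.Unit.Base using (⊤; tt)
open import Data.Vec.Base using (Vec; []; _∷_; lookup)
open import Data.Vec.Relation.Unary.All using ([]; _∷_) renaming (All to AllV)
open import Data.Vec.Relation.Unary.AllPairs as AllPairsV using ([]; _∷_) renaming (AllPairs to AllPairsV)
open import Function.Base using (_∘_; id)
open import Function.Bundles using (_⇔_; mk⇔; Equivalence)
open import Level using (Level)
open import Relation.Binary.Definitions using (tri<; tri≈; tri>)
open import Relation.Binary.PropositionalEquality as ≡ using (_≡_; _≢_)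
open import Relation.Nullary.Decidable using (Dec; yes; no; does; ¬?; _×-dec_; dec-true; dec-false; does-⇔)
open import Relation.Nullary.Negation.Core using (¬_; contradiction)
open import Relation.Unary using (Pred; Decidable)

-- The recursion `F` is not local in h: its value at h involves all larger x. Paired with q^h eₖ(1,
-- ..., q^{h-1}) it becomes local, since this family is stable under both operations involved.
-- Summation over h ≤ x raises k by one, because a monomial of eₖ₊₁ is determined by its largest
-- variable and the others; the shift only raises h. Splitting off the variable 1 then leads back to
-- the original variables with coefficients that do not depend on h.
--
-- Every enumeration is a sum over all words on an alphabet, weighted by 0/1 indicators of the
-- required properties. A combinatorial bijection thus becomes a reindexing of the alphabet, lifted
-- from letters to words. A permutation enters only as a repetition-free word; whenever some letter
-- has to occur, the argument is an inequality obtained from the pigeonhole principle.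

-- Index sets: antidiagonals, words and the relabelling `punchIn`

antidiagonal : ℕ → List (ℕ × ℕ)
antidiagonal zero    = (0 , 0) ∷ []
antidiagonal (suc n) = (0 , suc n) ∷ map (map₁ suc) (antidiagonal n)

antidiagonal-sum : ∀ n {m j} → (m , j) ∈ antidiagonal n → m +ℕ j ≡ n
antidiagonal-sum zero    (here ≡.refl) = ≡.refl
antidiagonal-sum (suc n) (here ≡.refl) = ≡.refl
antidiagonal-sum (suc n) (there p) with ∈-map⁻ (map₁ suc) p
... | _ , p′ , ≡.refl = ≡.cong suc (antidiagonal-sum n p′)

wordsℕ : (m l : ℕ) → List (List ℕ)
wordsℕ m zero    = [] ∷ []
wordsℕ m (suc l) = cartesianProductWith _∷_ (upTo m) (wordsℕ m l)

∈-wordsℕ⁻ : ∀ {m} l {w} → w ∈ wordsℕ m l → length w ≡ l × All (_< m) w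
∈-wordsℕ⁻ zero (here ≡.refl) = ≡.refl , []
∈-wordsℕ⁻ {m} (suc l) p with ∈-cartesianProductWith⁻ _∷_ (upTo m) (wordsℕ m l) p
... | x , w , x∈ , w∈ , ≡.refl with ∈-wordsℕ⁻ l w∈
...   | len , all = ≡.cong suc len , ∈-upTo⁻ x∈ ∷ all

punchIn : ℕ → ℕ → ℕ
punchIn zero    y       = suc y
punchIn (suc x) zero    = zero
punchIn (suc x) (suc y) = suc (punchIn x y)

-- Finite sums

module Sums {c ℓ} (R : CommutativeRing c ℓ) where
  open CommutativeRing R hiding (zero)
  open SumsAndPowers R
  open import Relation.Binary.Reasoning.Setoid setoid
  open import Algebra.Solver.Ring.NaturalCoefficients.Default commutativeSemiring using (solve; _:=_; _:+_; con)
  open import Algebra.Properties.CommutativeSemigroup +-commutativeSemigroup using (interchange)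

  ι : Bool → Carrier
  ι true  = 1#
  ι false = 0#

  [_] : ∀ {p} {P : Set p} → Dec P → Carrier
  [ P? ] = ι (does P?)

  ι-∧ : ∀ a b → ι (a ∧ b) ≈ ι a * ι b
  ι-∧ true  b = sym (*-identityˡ _)
  ι-∧ false b = sym (zeroˡ _)

  []-⇔ : ∀ {p r} {P : Set p} {Q : Set r} → P ⇔ Q → (P? : Dec P) (Q? : Dec Q) → [ P? ] ≈ [ Q? ]
  []-⇔ P⇔Q P? Q? = reflexive (≡.cong ι (does-⇔ P⇔Q P? Q?))

  []-cong : ∀ {p} {P : Set p} (P? : Dec P) {x y} → (P → x ≈ y) → [ P? ] * x ≈ [ P? ] * y
  []-cong (yes p) x≈y = *-congˡ (x≈y p)
  []-cong (no ¬p) _   = trans (zeroˡ _) (sym (zeroˡ _))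

  []-true : ∀ {p} {P : Set p} (P? : Dec P) → P → [ P? ] ≈ 1#
  []-true (yes _) p = refl
  []-true (no ¬p) p = contradiction p ¬p

  []-false : ∀ {p} {P : Set p} (P? : Dec P) → ¬ P → [ P? ] ≈ 0#
  []-false (yes p) ¬p = contradiction p ¬p
  []-false (no _)  ¬p = refl

  module _ {a} {A : Set a} where

    ∑-cong-∈ : ∀ (xs : List A) {f g : A → Carrier} → (∀ {x} → x ∈ xs → f x ≈ g x) → ∑ xs f ≈ ∑ xs g
    ∑-cong-∈ []       f≈g = refl
    ∑-cong-∈ (x ∷ xs) f≈g = +-cong (f≈g (here ≡.refl)) (∑-cong-∈ xs (f≈g ∘ there))

    ∑-cong : ∀ (xs : List A) {f g : A → Carrier} → (∀ x → f x ≈ g x) → ∑ xs f ≈ ∑ xs g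
    ∑-cong xs f≈g = ∑-cong-∈ xs (λ {x} _ → f≈g x)

    ∑-zero : ∀ (xs : List A) → ∑ xs (λ _ → 0#) ≈ 0#
    ∑-zero []       = refl
    ∑-zero (x ∷ xs) = trans (+-identityˡ _) (∑-zero xs)

    ∑-+ : ∀ (xs : List A) f g → ∑ xs (λ x → f x + g x) ≈ ∑ xs f + ∑ xs g
    ∑-+ []       f g = sym (+-identityˡ 0#)
    ∑-+ (x ∷ xs) f g = trans (+-congˡ (∑-+ xs f g)) (interchange _ _ _ _)

    ∑-*ˡ : ∀ (xs : List A) y f → ∑ xs (λ x → y * f x) ≈ y * ∑ xs f
    ∑-*ˡ []       y f = sym (zeroʳ y)
    ∑-*ˡ (x ∷ xs) y f = trans (+-congˡ (∑-*ˡ xs y f)) (sym (distribˡ y _ _))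

    ∑-*ʳ : ∀ (xs : List A) y f → ∑ xs (λ x → f x * y) ≈ ∑ xs f * y
    ∑-*ʳ xs y f = trans (∑-cong xs (λ x → *-comm (f x) y)) (trans (∑-*ˡ xs y f) (*-comm y _))

    ∑-++ : ∀ (xs ys : List A) f → ∑ (xs ++ ys) f ≈ ∑ xs f + ∑ ys f
    ∑-++ []       ys f = sym (+-identityˡ _)
    ∑-++ (x ∷ xs) ys f = trans (+-congˡ (∑-++ xs ys f)) (sym (+-assoc _ _ _))

    ∑-filter : ∀ {p} {P : Pred A p} (P? : Decidable P) (xs : List A) f →
               ∑ (filter P? xs) f ≈ ∑ xs (λ x → [ P? x ] * f x)
    ∑-filter P? []       f = refl
    ∑-filter P? (x ∷ xs) f with does (P? x)
    ... | true  = +-cong (sym (*-identityˡ _)) (∑-filter P? xs f)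
    ... | false = trans (∑-filter P? xs f) (sym (trans (+-congʳ (zeroˡ _)) (+-identityˡ _)))

  ∑-comm : ∀ {a b} {A : Set a} {B : Set b} (xs : List A) (ys : List B) (f : A → B → Carrier) →
           ∑ xs (λ x → ∑ ys (f x)) ≈ ∑ ys (λ y → ∑ xs (λ x → f x y))
  ∑-comm []       ys f = sym (∑-zero ys)
  ∑-comm (x ∷ xs) ys f = trans (+-congˡ (∑-comm xs ys f)) (sym (∑-+ ys _ _))

  ∑-map : ∀ {a b} {A : Set a} {B : Set b} (h : A → B) xs f → ∑ (map h xs) f ≈ ∑ xs (f ∘ h)
  ∑-map h []       f = refl
  ∑-map h (x ∷ xs) f = +-congˡ (∑-map h xs f)

  ∑-cartesianProductWith : ∀ {a b d} {A : Set a} {B : Set b} {D : Set d} (h : A → B → D) xs ys f →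
    ∑ (cartesianProductWith h xs ys) f ≈ ∑ xs (λ x → ∑ ys (f ∘ h x))
  ∑-cartesianProductWith h []       ys f = refl
  ∑-cartesianProductWith h (x ∷ xs) ys f =
    trans (∑-++ (map (h x) ys) _ f) (+-cong (∑-map (h x) ys f) (∑-cartesianProductWith h xs ys f))

  ∑-applyUpTo : ∀ {a} {A : Set a} (h : ℕ → A) n f → ∑ (applyUpTo h n) f ≈ ∑ (upTo n) (f ∘ h)
  ∑-applyUpTo h n f =
    trans (reflexive (≡.cong (λ xs → ∑ xs f) (≡.sym (map-applyUpTo id h n)))) (∑-map h (upTo n) f)

  ∑<-suc : ∀ n f → ∑ (upTo (suc n)) f ≈ f 0 + ∑ (upTo n) (f ∘ suc)
  ∑<-suc n f = +-congˡ (∑-applyUpTo suc n f)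

  ∑<-last : ∀ n f → ∑ (upTo (suc n)) f ≈ ∑ (upTo n) f + f n
  ∑<-last zero    f = +-comm _ _
  ∑<-last (suc n) f = begin
    ∑ (upTo (suc (suc n))) f                  ≈⟨ ∑<-suc (suc n) f ⟩
    f 0 + ∑ (upTo (suc n)) (f ∘ suc)          ≈⟨ +-congˡ (∑<-last n (f ∘ suc)) ⟩
    f 0 + (∑ (upTo n) (f ∘ suc) + f (suc n))  ≈⟨ +-assoc _ _ _ ⟨
    f 0 + ∑ (upTo n) (f ∘ suc) + f (suc n)    ≈⟨ +-congʳ (∑<-suc n f) ⟨
    ∑ (upTo (suc n)) f + f (suc n)            ∎

  ∑-antidiagonal-suc : ∀ n f →
    ∑ (antidiagonal (suc n)) f ≈ f (0 , suc n) + ∑ (antidiagonal n) (λ (m , j) → f (suc m , j))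
  ∑-antidiagonal-suc n f = +-congˡ (∑-map (map₁ suc) (antidiagonal n) f)

  ∑-antidiagonal-last : ∀ n f →
    ∑ (antidiagonal (suc n)) f ≈ f (suc n , 0) + ∑ (antidiagonal n) (λ (m , j) → f (m , suc j))
  ∑-antidiagonal-last zero f = solve 2 (λ x y → x :+ (y :+ con 0) := y :+ (x :+ con 0)) refl _ _
  ∑-antidiagonal-last (suc n) f = begin
    ∑ (antidiagonal (suc (suc n))) f
      ≈⟨ ∑-antidiagonal-suc (suc n) f ⟩
    f (0 , suc (suc n)) + ∑ (antidiagonal (suc n)) (λ (m , j) → f (suc m , j))
      ≈⟨ +-congˡ (∑-antidiagonal-last n _) ⟩
    f (0 , suc (suc n)) + (f (suc (suc n) , 0) + ∑ (antidiagonal n) (λ (m , j) → f (suc m , suc j)))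
      ≈⟨ solve 3 (λ x y z → x :+ (y :+ z) := y :+ (x :+ z)) refl _ _ _ ⟩
    f (suc (suc n) , 0) + (f (0 , suc (suc n)) + ∑ (antidiagonal n) (λ (m , j) → f (suc m , suc j)))
      ≈⟨ +-congˡ (∑-antidiagonal-suc n (λ (m , j) → f (m , suc j))) ⟨
    f (suc (suc n) , 0) + ∑ (antidiagonal (suc n)) (λ (m , j) → f (m , suc j)) ∎

  ∑<-below : ∀ a b f → ∑ (upTo (a +ℕ b)) (λ x → [ x ℕ.<? a ] * f x) ≈ ∑ (upTo a) f
  ∑<-below zero b f = trans (∑-cong (upTo b) (λ x → zeroˡ (f x))) (∑-zero (upTo b))
  ∑<-below (suc a) b f = begin
    ∑ (upTo (suc a +ℕ b)) (λ x → [ x ℕ.<? suc a ] * f x)        ≈⟨ ∑<-suc (a +ℕ b) _ ⟩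
    1# * f 0 + ∑ (upTo (a +ℕ b)) (λ x → [ x ℕ.<? a ] * f (suc x)) ≈⟨ +-cong (*-identityˡ _) (∑<-below a b (f ∘ suc)) ⟩
    f 0 + ∑ (upTo a) (f ∘ suc)                                   ≈⟨ ∑<-suc a f ⟨
    ∑ (upTo (suc a)) f                                           ∎

  ∑<-above : ∀ a b f → ∑ (upTo (a +ℕ b)) (λ x → [ a ℕ.≤? x ] * f x) ≈ ∑ (upTo b) (f ∘ (a +ℕ_))
  ∑<-above zero b f = ∑-cong (upTo b) (λ x → *-identityˡ (f x))
  ∑<-above (suc a) b f = begin
    ∑ (upTo (suc a +ℕ b)) (λ x → [ suc a ℕ.≤? x ] * f x)              ≈⟨ ∑<-suc (a +ℕ b) _ ⟩
    0# * f 0 + ∑ (upTo (a +ℕ b)) (λ x → [ suc a ℕ.≤? suc x ] * f (suc x)) ≈⟨ +-cong (zeroˡ _) (∑-cong (upTo (a +ℕ b)) (λ x → *-congʳ (reflexive (≡.cong ι (s≤ᵇ a x))))) ⟩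
    0# + ∑ (upTo (a +ℕ b)) (λ x → [ a ℕ.≤? x ] * f (suc x))           ≈⟨ +-identityˡ _ ⟩
    ∑ (upTo (a +ℕ b)) (λ x → [ a ℕ.≤? x ] * f (suc x))                ≈⟨ ∑<-above a b (f ∘ suc) ⟩
    ∑ (upTo b) (f ∘ (suc a +ℕ_)) ∎
    where
    s≤ᵇ : ∀ a x → does (suc a ℕ.≤? suc x) ≡ does (a ℕ.≤? x)
    s≤ᵇ zero    x = ≡.refl
    s≤ᵇ (suc a) x = ≡.refl

  ∑<-punchIn : ∀ x n f → x ≤ n →
    ∑ (upTo (suc n)) (λ y → [ ¬? (x ℕ.≟ y) ] * f y) ≈ ∑ (upTo n) (f ∘ punchIn x)
  ∑<-punchIn zero n f _ = begin
    ∑ (upTo (suc n)) (λ y → [ ¬? (0 ℕ.≟ y) ] * f y)        ≈⟨ ∑<-suc n _ ⟩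
    0# * f 0 + ∑ (upTo n) (λ y → 1# * f (suc y))       ≈⟨ +-cong (zeroˡ _) (∑-cong (upTo n) (λ y → *-identityˡ _)) ⟩
    0# + ∑ (upTo n) (f ∘ suc)                          ≈⟨ +-identityˡ _ ⟩
    ∑ (upTo n) (f ∘ suc)                               ∎
  ∑<-punchIn (suc x) (suc n) f (s≤s x≤n) = begin
    ∑ (upTo (suc (suc n))) (λ y → [ ¬? (suc x ℕ.≟ y) ] * f y)      ≈⟨ ∑<-suc (suc n) _ ⟩
    1# * f 0 + ∑ (upTo (suc n)) (λ y → [ ¬? (x ℕ.≟ y) ] * f (suc y)) ≈⟨ +-cong (*-identityˡ _) (∑<-punchIn x n (f ∘ suc) x≤n) ⟩
    f 0 + ∑ (upTo n) (f ∘ suc ∘ punchIn x)                    ≈⟨ ∑<-suc n (f ∘ punchIn (suc x)) ⟨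
    ∑ (upTo (suc n)) (f ∘ punchIn (suc x))                    ∎

  ∑-wordsℕ-suc : ∀ m l f → ∑ (wordsℕ m (suc l)) f ≈ ∑ (upTo m) (λ x → ∑ (wordsℕ m l) (f ∘ (x ∷_)))
  ∑-wordsℕ-suc m l = ∑-cartesianProductWith _∷_ (upTo m) (wordsℕ m l)

  -- Standardisation of words: if `e` enumerates the letters satisfying `Q`, then `map e` enumerates
  -- the words over them. The one-letter hypothesis is supplied by `∑<-below`, `∑<-above` and
  -- `∑<-punchIn`.
  ∑-wordsℕ-embed : ∀ {p} {Q : Pred ℕ p} (Q? : Decidable Q) m m′ (e : ℕ → ℕ) →
    (∀ f → ∑ (upTo m) (λ x → [ Q? x ] * f x) ≈ ∑ (upTo m′) (f ∘ e)) →
    ∀ l g → ∑ (wordsℕ m l) (λ w → [ all? Q? w ] * g w) ≈ ∑ (wordsℕ m′ l) (g ∘ map e)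
  ∑-wordsℕ-embed Q? m m′ e embed zero    g = +-congʳ (*-identityˡ _)
  ∑-wordsℕ-embed Q? m m′ e embed (suc l) g = begin
    ∑ (wordsℕ m (suc l)) (λ w → [ all? Q? w ] * g w)
      ≈⟨ ∑-wordsℕ-suc m l _ ⟩
    ∑ (upTo m) (λ x → ∑ (wordsℕ m l) (λ w → [ all? Q? (x ∷ w) ] * g (x ∷ w)))
      ≈⟨ ∑-cong (upTo m) (λ x → trans
           (∑-cong (wordsℕ m l) (λ w → trans (*-congʳ (ι-∧ (does (Q? x)) _)) (*-assoc _ _ _)))
           (∑-*ˡ (wordsℕ m l) _ _)) ⟩
    ∑ (upTo m) (λ x → [ Q? x ] * ∑ (wordsℕ m l) (λ w → [ all? Q? w ] * g (x ∷ w)))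
      ≈⟨ ∑-cong (upTo m) (λ x → *-congˡ (∑-wordsℕ-embed Q? m m′ e embed l (g ∘ (x ∷_)))) ⟩
    ∑ (upTo m) (λ x → [ Q? x ] * ∑ (wordsℕ m′ l) (λ w → g (x ∷ map e w)))
      ≈⟨ embed _ ⟩
    ∑ (upTo m′) (λ x → ∑ (wordsℕ m′ l) (λ w → g (e x ∷ map e w)))
      ≈⟨ ∑-wordsℕ-suc m′ l _ ⟨
    ∑ (wordsℕ m′ (suc l)) (g ∘ map e) ∎

-- Weighted Motzkin paths

module Paths {c ℓ} (R : CommutativeRing c ℓ) (t q : CommutativeRing.Carrier R) where
  open CommutativeRing R hiding (zero)
  open SumsAndPowers R
  open Sums R
  open import Relation.Binary.Reasoning.Setoid setoid
  open import Algebra.Solver.Ring.NaturalCoefficients.Default commutativeSemiring using (solve; _:=_; _:+_; _:*_; con)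

  -- F r h is the total weight of the ways to append the last r letters, h of which lie below the current
  -- record; only h ≤ r is meaningful.  A new record that exceeds x of the remaining letters has weight
  -- t q^x; otherwise the smallest remaining letter is appended.
  shift : (ℕ → Carrier) → ℕ → Carrier
  shift f zero    = 0#
  shift f (suc h) = f h

  F : ℕ → ℕ → Carrier
  F zero    h = 1#
  F (suc r) h = shift (F r) h + ∑ (upTo (suc r)) (λ x → [ h ℕ.<? suc x ] * (t * q ^ x * F r x))

  -- E h k = eₖ(1, q, …, q^{h-1}).
  E : ℕ → ℕ → Carrier
  E h       zero    = 1#
  E zero    (suc k) = 0#
  E (suc h) (suc k) = E h (suc k) + q ^ h * E h k

  -- The variables 1, …, q^h are 1 together with q times the variables 1, …, q^{h-1}.
  E-scale : ∀ h k → E (suc h) (suc k) ≈ q ^ k * E h k + q ^ suc k * E h (suc k)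
  E-scale zero zero = solve 1 (λ q → con 0 :+ con 1 :* con 1 := con 1 :* con 1 :+ q :* con 1 :* con 0) refl q
  E-scale zero (suc k) = solve 2 (λ q p → con 0 :+ con 1 :* con 0 := q :* p :* con 0 :+ q :* (q :* p) :* con 0) refl q (q ^ k)
  E-scale (suc h) zero = begin
    E (suc h) 1 + q ^ suc h * 1#
      ≈⟨ +-congʳ (E-scale h zero) ⟩
    1# * 1# + q ^ 1 * E h 1 + q ^ suc h * 1#
      ≈⟨ solve 3 (λ q e p → con 1 :* con 1 :+ q :* con 1 :* e :+ q :* p :* con 1
                         := con 1 :* con 1 :+ q :* con 1 :* (e :+ p :* con 1)) refl q (E h 1) (q ^ h) ⟩
    1# * 1# + q ^ 1 * (E h 1 + q ^ h * 1#) ∎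
  E-scale (suc h) (suc k) = begin
    E (suc h) (suc (suc k)) + q ^ suc h * E (suc h) (suc k)
      ≈⟨ +-cong (E-scale h (suc k)) (*-congˡ (E-scale h k)) ⟩
    (q ^ suc k * E h (suc k) + q ^ suc (suc k) * E h (suc (suc k)))
      + q ^ suc h * (q ^ k * E h k + q ^ suc k * E h (suc k))
      ≈⟨ solve 6 (λ q a b e₀ e₁ e₂ →
           q :* a :* e₁ :+ q :* (q :* a) :* e₂ :+ q :* b :* (a :* e₀ :+ q :* a :* e₁)
           := q :* a :* (e₁ :+ b :* e₀) :+ q :* (q :* a) :* (e₂ :+ b :* e₁))
           refl q (q ^ k) (q ^ h) (E h k) (E h (suc k)) (E h (suc (suc k))) ⟩
    q ^ suc k * E (suc h) (suc k) + q ^ suc (suc k) * E (suc h) (suc (suc k)) ∎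

  -- The monomials of eₖ₊₁ are sorted by their variable q^h with the largest h.
  E-sum : ∀ i k → ∑ (upTo i) (λ h → q ^ h * E h k) ≈ E i (suc k)
  E-sum zero    k = refl
  E-sum (suc i) k = trans (∑<-last i _) (+-congʳ (E-sum i k))

  -- This turns out to be the total weight of the paths of r steps from level 0 to level k. The
  -- factor q^h is the one that `E-sum` needs.
  X : ℕ → ℕ → Carrier
  X r k = ∑ (upTo (suc r)) (λ h → F r h * (q ^ h * E h k))

  -- The shift in `F` replaces h by i + 1. In the record term the sums are exchanged; for fixed x
  -- there remains the sum of q^h `E h k` over h ≤ x, which `E-sum` evaluates.
  X-E : ∀ r k → X (suc r) k ≈ ∑ (upTo (suc r)) (λ i → F r i * (q ^ i * (q * E (suc i) k + t * E (suc i) (suc k))))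
  X-E r k = begin
    ∑ H (λ h → (shift (F r) h + ∑ I (λ x → [ h ℕ.<? suc x ] * b x)) * a h)
      ≈⟨ ∑-cong H (λ h → distribʳ _ _ _) ⟩
    ∑ H (λ h → shift (F r) h * a h + ∑ I (λ x → [ h ℕ.<? suc x ] * b x) * a h)
      ≈⟨ ∑-+ H _ _ ⟩
    ∑ H (λ h → shift (F r) h * a h) + ∑ H (λ h → ∑ I (λ x → [ h ℕ.<? suc x ] * b x) * a h)
      ≈⟨ +-cong left right ⟩
    ∑ I (λ i → F r i * a (suc i)) + ∑ I (λ i → b i * E (suc i) (suc k))
      ≈⟨ ∑-+ I _ _ ⟨
    ∑ I (λ i → F r i * a (suc i) + b i * E (suc i) (suc k))
      ≈⟨ ∑-cong I (λ i → solve 6 (λ f p q t e e′ → f :* (q :* p :* e) :+ t :* p :* f :* e′ := f :* (p :* (q :* e :+ t :* e′)))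
           refl (F r i) (q ^ i) q t (E (suc i) k) (E (suc i) (suc k))) ⟩
    ∑ I (λ i → F r i * (q ^ i * (q * E (suc i) k + t * E (suc i) (suc k)))) ∎
    where
    H = upTo (suc (suc r))
    I = upTo (suc r)
    a b : ℕ → Carrier
    a h = q ^ h * E h k
    b x = t * q ^ x * F r x
    left : ∑ H (λ h → shift (F r) h * a h) ≈ ∑ I (λ i → F r i * a (suc i))
    left = trans (∑<-suc (suc r) _) (trans (+-congʳ (zeroˡ _)) (+-identityˡ _))
    inner : ∀ {x} → x ≤ r → ∑ H (λ h → [ h ℕ.<? suc x ] * a h) ≈ E (suc x) (suc k)
    inner {x} x≤r = begin
      ∑ H (λ h → [ h ℕ.<? suc x ] * a h)
        ≡⟨ ≡.cong (λ n → ∑ (upTo n) (λ h → [ h ℕ.<? suc x ] * a h)) (ℕ.m+[n∸m]≡n (s≤s (ℕ.m≤n⇒m≤1+n x≤r))) ⟨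
      ∑ (upTo (suc x +ℕ (suc r ∸ x))) (λ h → [ h ℕ.<? suc x ] * a h)
        ≈⟨ ∑<-below (suc x) (suc r ∸ x) a ⟩
      ∑ (upTo (suc x)) a
        ≈⟨ E-sum (suc x) k ⟩
      E (suc x) (suc k) ∎
    right : ∑ H (λ h → ∑ I (λ x → [ h ℕ.<? suc x ] * b x) * a h) ≈ ∑ I (λ i → b i * E (suc i) (suc k))
    right = begin
      ∑ H (λ h → ∑ I (λ x → [ h ℕ.<? suc x ] * b x) * a h)
        ≈⟨ ∑-cong H (λ h → ∑-*ʳ I (a h) _) ⟨
      ∑ H (λ h → ∑ I (λ x → [ h ℕ.<? suc x ] * b x * a h))
        ≈⟨ ∑-comm H I _ ⟩
      ∑ I (λ x → ∑ H (λ h → [ h ℕ.<? suc x ] * b x * a h))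
        ≈⟨ ∑-cong I (λ x → trans (∑-cong H (λ h → solve 3 (λ i b a → i :* b :* a := b :* (i :* a)) refl [ h ℕ.<? suc x ] (b x) (a h))) (∑-*ˡ H (b x) _)) ⟩
      ∑ I (λ x → b x * ∑ H (λ h → [ h ℕ.<? suc x ] * a h))
        ≈⟨ ∑-cong-∈ I (λ x∈ → *-congˡ (inner (ℕ.≤-pred (∈-upTo⁻ x∈)))) ⟩
      ∑ I (λ x → b x * E (suc x) (suc k)) ∎

  X-zero : X 0 0 ≈ 1#
  X-zero = solve 0 (con 1 :* (con 1 :* con 1) :+ con 0 := con 1) refl

  X-zero-suc : ∀ k → X 0 (suc k) ≈ 0#
  X-zero-suc k = solve 0 (con 1 :* (con 1 :* con 0) :+ con 0 := con 0) refl

  X-suc-zero : ∀ r → X (suc r) 0 ≈ (q + t) * X r 0 + t * q * X r 1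
  X-suc-zero r = begin
    X (suc r) 0
      ≈⟨ X-E r 0 ⟩
    ∑ I (λ i → F r i * (q ^ i * (q * 1# + t * E (suc i) 1)))
      ≈⟨ ∑-cong I (λ i → trans (*-congˡ (*-congˡ (+-congˡ (*-congˡ (E-scale i 0)))))
           (solve 5 (λ f p q t e → f :* (p :* (q :* con 1 :+ t :* (con 1 :* con 1 :+ q :* con 1 :* e)))
             := (q :+ t) :* (f :* (p :* con 1)) :+ t :* q :* (f :* (p :* e))) refl (F r i) (q ^ i) q t (E i 1))) ⟩
    ∑ I (λ i → (q + t) * (F r i * (q ^ i * 1#)) + t * q * (F r i * (q ^ i * E i 1)))
      ≈⟨ trans (∑-+ I _ _) (+-cong (∑-*ˡ I _ _) (∑-*ˡ I _ _)) ⟩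
    (q + t) * X r 0 + t * q * X r 1 ∎
    where I = upTo (suc r)

  -- The three terms are the last steps into level k + 1: up with weight q^{k+1}, level with (q + t)
  -- q^{k+1}, down with t q^{k+2}. Each weight is q times that of the same step one level lower.
  X-suc-suc : ∀ r k → X (suc r) (suc k) ≈
    q ^ suc k * X r k + (q + t) * q ^ suc k * X r (suc k) + t * q ^ suc (suc k) * X r (suc (suc k))
  X-suc-suc r k = begin
    X (suc r) (suc k)
      ≈⟨ X-E r (suc k) ⟩
    ∑ I (λ i → F r i * (q ^ i * (q * E (suc i) (suc k) + t * E (suc i) (suc (suc k)))))
      ≈⟨ ∑-cong I (λ i → trans
           (*-congˡ (*-congˡ (+-cong (*-congˡ (E-scale i k)) (*-congˡ (E-scale i (suc k))))))
           (solve 8 (λ f p q t a e₀ e₁ e₂ →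
               f :* (p :* (q :* (a :* e₀ :+ q :* a :* e₁) :+ t :* (q :* a :* e₁ :+ q :* (q :* a) :* e₂)))
               := q :* a :* (f :* (p :* e₀)) :+ (q :+ t) :* (q :* a) :* (f :* (p :* e₁))
                  :+ t :* (q :* (q :* a)) :* (f :* (p :* e₂)))
             refl (F r i) (q ^ i) q t (q ^ k) (E i k) (E i (suc k)) (E i (suc (suc k))))) ⟩
    ∑ I (λ i → q ^ suc k * (F r i * (q ^ i * E i k)) + (q + t) * q ^ suc k * (F r i * (q ^ i * E i (suc k)))
               + t * q ^ suc (suc k) * (F r i * (q ^ i * E i (suc (suc k)))))
      ≈⟨ trans (∑-+ I _ _) (+-cong (trans (∑-+ I _ _) (+-cong (∑-*ˡ I _ _) (∑-*ˡ I _ _))) (∑-*ˡ I _ _)) ⟩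
    q ^ suc k * X r k + (q + t) * q ^ suc k * X r (suc k) + t * q ^ suc (suc k) * X r (suc (suc k)) ∎
    where I = upTo (suc r)

  -- A path from level 0 to level k+1 is cut at its last visit to level 0.
  lastPassage : ∀ n k → X (suc n) (suc k) ≈ ∑ (antidiagonal n) (λ (m , j) → X m 0 * (q ^ suc j * X j k))
  lastPassage zero zero = begin
    X 1 1
      ≈⟨ X-suc-suc 0 0 ⟩
    q ^ 1 * X 0 0 + (q + t) * q ^ 1 * X 0 1 + t * q ^ 2 * X 0 2
      ≈⟨ +-cong (+-congˡ (*-congˡ (X-zero-suc 0))) (*-congˡ (X-zero-suc 1)) ⟩
    q ^ 1 * X 0 0 + (q + t) * q ^ 1 * 0# + t * q ^ 2 * 0#
      ≈⟨ solve 3 (λ q t x → q :* con 1 :* x :+ (q :+ t) :* (q :* con 1) :* con 0 :+ t :* (q :* (q :* con 1)) :* con 0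
           := con 1 :* (q :* con 1 :* x) :+ con 0) refl q t (X 0 0) ⟩
    1# * (q ^ 1 * X 0 0) + 0#
      ≈⟨ +-congʳ (*-congʳ X-zero) ⟨
    X 0 0 * (q ^ 1 * X 0 0) + 0# ∎
  lastPassage zero (suc k) = begin
    X 1 (suc (suc k))
      ≈⟨ X-suc-suc 0 (suc k) ⟩
    q ^ suc (suc k) * X 0 (suc k) + (q + t) * q ^ suc (suc k) * X 0 (suc (suc k)) + t * q ^ suc (suc (suc k)) * X 0 (suc (suc (suc k)))
      ≈⟨ +-cong (+-cong (*-congˡ (X-zero-suc k)) (*-congˡ (X-zero-suc (suc k)))) (*-congˡ (X-zero-suc (suc (suc k)))) ⟩
    q ^ suc (suc k) * 0# + (q + t) * q ^ suc (suc k) * 0# + t * q ^ suc (suc (suc k)) * 0#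
      ≈⟨ solve 5 (λ q t a b x → a :* con 0 :+ (q :+ t) :* a :* con 0 :+ t :* b :* con 0
           := x :* (q :* con 1 :* con 0) :+ con 0) refl q t (q ^ suc (suc k)) (q ^ suc (suc (suc k))) (X 0 0) ⟩
    X 0 0 * (q ^ 1 * 0#) + 0#
      ≈⟨ +-congʳ (*-congˡ (*-congˡ (X-zero-suc k))) ⟨
    X 0 0 * (q ^ 1 * X 0 (suc k)) + 0# ∎
  lastPassage (suc n) zero = begin
    X (suc (suc n)) 1
      ≈⟨ X-suc-suc (suc n) 0 ⟩
    q ^ 1 * X (suc n) 0 + (q + t) * q ^ 1 * X (suc n) 1 + t * q ^ 2 * X (suc n) 2
      ≈⟨ +-cong (+-congˡ (*-congˡ (lastPassage n 0))) (*-congˡ (lastPassage n 1)) ⟩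
    q ^ 1 * X (suc n) 0 + (q + t) * q ^ 1 * ∑ A (λ (m , j) → X m 0 * (q ^ suc j * X j 0))
      + t * q ^ 2 * ∑ A (λ (m , j) → X m 0 * (q ^ suc j * X j 1))
      ≈⟨ +-cong (+-congˡ (∑-*ˡ A _ _)) (∑-*ˡ A _ _) ⟨
    q ^ 1 * X (suc n) 0 + ∑ A (λ (m , j) → (q + t) * q ^ 1 * (X m 0 * (q ^ suc j * X j 0)))
      + ∑ A (λ (m , j) → t * q ^ 2 * (X m 0 * (q ^ suc j * X j 1)))
      ≈⟨ trans (+-assoc _ _ _) (+-congˡ (sym (∑-+ A _ _))) ⟩
    q ^ 1 * X (suc n) 0 + ∑ A (λ (m , j) → (q + t) * q ^ 1 * (X m 0 * (q ^ suc j * X j 0))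
                                           + t * q ^ 2 * (X m 0 * (q ^ suc j * X j 1)))
      -- The separate summand consists of the paths whose last step is the one that leaves level 0.
      -- In all others the last step belongs to the raised part of the path and is absorbed by
      -- `X-suc-zero`.
      ≈⟨ +-cong
           (trans (solve 2 (λ p x → p :* x := x :* (p :* con 1)) refl (q ^ 1) (X (suc n) 0)) (*-congˡ (*-congˡ (sym X-zero))))
           (∑-cong A (λ (m , j) → trans
             (solve 6 (λ q t y p x₀ x₁ →
               (q :+ t) :* (q :* con 1) :* (y :* (q :* p :* x₀)) :+ t :* (q :* (q :* con 1)) :* (y :* (q :* p :* x₁))
               := y :* (q :* (q :* p) :* ((q :+ t) :* x₀ :+ t :* q :* x₁))) refl q t (X m 0) (q ^ j) (X j 0) (X j 1))
             (*-congˡ (*-congˡ (sym (X-suc-zero j)))))) ⟩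
    X (suc n) 0 * (q ^ 1 * X 0 0) + ∑ A (λ (m , j) → X m 0 * (q ^ suc (suc j) * X (suc j) 0))
      ≈⟨ ∑-antidiagonal-last n _ ⟨
    ∑ (antidiagonal (suc n)) (λ (m , j) → X m 0 * (q ^ suc j * X j 0)) ∎
    where A = antidiagonal n
  lastPassage (suc n) (suc k) = begin
    X (suc (suc n)) (suc (suc k))
      ≈⟨ X-suc-suc (suc n) (suc k) ⟩
    c₀ * X (suc n) (suc k) + c₁ * X (suc n) (suc (suc k)) + c₂ * X (suc n) (suc (suc (suc k)))
      ≈⟨ +-cong (+-cong (*-congˡ (lastPassage n k)) (*-congˡ (lastPassage n (suc k)))) (*-congˡ (lastPassage n (suc (suc k)))) ⟩
    c₀ * ∑ A (f k) + c₁ * ∑ A (f (suc k)) + c₂ * ∑ A (f (suc (suc k)))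
      ≈⟨ +-cong (trans (∑-+ A _ _) (+-cong (∑-*ˡ A _ _) (∑-*ˡ A _ _))) (∑-*ˡ A _ _) ⟨
    ∑ A (λ p → c₀ * f k p + c₁ * f (suc k) p) + ∑ A (λ p → c₂ * f (suc (suc k)) p)
      ≈⟨ ∑-+ A _ _ ⟨
    ∑ A (λ p → c₀ * f k p + c₁ * f (suc k) p + c₂ * f (suc (suc k)) p)
      ≈⟨ ∑-cong A (λ (m , j) → trans
           (solve 8 (λ q t y p b x₀ x₁ x₂ →
               q :* (q :* b) :* (y :* (q :* p :* x₀)) :+ (q :+ t) :* (q :* (q :* b)) :* (y :* (q :* p :* x₁))
                 :+ t :* (q :* (q :* (q :* b))) :* (y :* (q :* p :* x₂))
               := y :* (q :* (q :* p) :* (q :* b :* x₀ :+ (q :+ t) :* (q :* b) :* x₁ :+ t :* (q :* (q :* b)) :* x₂)))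
             refl q t (X m 0) (q ^ j) (q ^ k) (X j k) (X j (suc k)) (X j (suc (suc k))))
           (*-congˡ (*-congˡ (sym (X-suc-suc j k))))) ⟩
    ∑ A (λ (m , j) → X m 0 * (q ^ suc (suc j) * X (suc j) (suc k)))
      -- The summand m = n + 1 may be added: its raised part has no steps and so cannot end at level
      -- k + 1 > 0.
      ≈⟨ +-identityˡ _ ⟨
    0# + ∑ A (λ (m , j) → X m 0 * (q ^ suc (suc j) * X (suc j) (suc k)))
      ≈⟨ +-congʳ (trans (*-congˡ (trans (*-congˡ (X-zero-suc k)) (zeroʳ _))) (zeroʳ _)) ⟨
    X (suc n) 0 * (q ^ 1 * X 0 (suc k)) + ∑ A (λ (m , j) → X m 0 * (q ^ suc (suc j) * X (suc j) (suc k)))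
      ≈⟨ ∑-antidiagonal-last n _ ⟨
    ∑ (antidiagonal (suc n)) (λ (m , j) → X m 0 * (q ^ suc j * X j (suc k))) ∎
    where
    A = antidiagonal n
    c₀ = q ^ suc (suc k)
    c₁ = (q + t) * q ^ suc (suc k)
    c₂ = t * q ^ suc (suc (suc k))
    f : ℕ → ℕ × ℕ → Carrier
    f k (m , j) = X m 0 * (q ^ suc j * X j k)

  -- The first letter is always a record, so every test in `F` succeeds at h = 0; what remains is
  -- `X n 0` because `E h 0` is 1.
  F-X : ∀ n → F (suc n) 0 ≈ t * X n 0
  F-X n = begin
    0# + ∑ (upTo (suc n)) (λ x → 1# * (t * q ^ x * F n x))
      ≈⟨ +-identityˡ _ ⟩
    ∑ (upTo (suc n)) (λ x → 1# * (t * q ^ x * F n x))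
      ≈⟨ ∑-cong (upTo (suc n)) (λ x → solve 3 (λ t p f → con 1 :* (t :* p :* f) := t :* (f :* (p :* con 1))) refl t (q ^ x) (F n x)) ⟩
    ∑ (upTo (suc n)) (λ x → t * (F n x * (q ^ x * 1#)))
      ≈⟨ ∑-*ˡ (upTo (suc n)) t _ ⟩
    t * X n 0 ∎

  F-step : ∀ n → F (suc (suc n)) 0 ≈ (q + t) * F (suc n) 0 + t * (t * q * X n 1)
  F-step n = trans (F-X (suc n)) (trans (*-congˡ (X-suc-zero n))
    (trans (solve 4 (λ u t x y → t :* (u :* x :+ y) := u :* (t :* x) :+ t :* y) refl (q + t) t (X n 0) (t * q * X n 1))
      (+-congʳ (*-congˡ (sym (F-X n))))))

  F-one : F 1 0 ≈ t
  F-one = trans (F-X 0) (trans (*-congˡ X-zero) (*-identityʳ t))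

  F-two : F 2 0 ≈ (q + t) * F 1 0
  F-two = trans (F-step 0) (trans (+-congˡ (trans (*-congˡ (trans (*-congˡ (X-zero-suc 0)) (zeroʳ _))) (zeroʳ t))) (+-identityʳ _))

  -- `X (suc n) 1` counts paths that are one down step short of level 0. That step has weight t q:
  -- its q raises the q^{b+1} of `lastPassage` to q^{b+2}, while its t and the t of `F-X` turn both
  -- path factors into values of `F`.
  F-convolution : ∀ n → F (suc (suc (suc n))) 0 ≈
    (q + t) * F (suc (suc n)) 0 + ∑ (antidiagonal n) (λ (a , b) → q ^ suc (suc b) * (F (suc a) 0 * F (suc b) 0))
  F-convolution n = begin
    F (suc (suc (suc n))) 0
      ≈⟨ F-step (suc n) ⟩
    (q + t) * F (suc (suc n)) 0 + t * (t * q * X (suc n) 1)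
      ≈⟨ +-congˡ (begin
        t * (t * q * X (suc n) 1)
          ≈⟨ *-assoc _ _ _ ⟨
        t * (t * q) * X (suc n) 1
          ≈⟨ *-congˡ (lastPassage n 0) ⟩
        t * (t * q) * ∑ A (λ (a , b) → X a 0 * (q ^ suc b * X b 0))
          ≈⟨ ∑-*ˡ A _ _ ⟨
        ∑ A (λ (a , b) → t * (t * q) * (X a 0 * (q ^ suc b * X b 0)))
          ≈⟨ ∑-cong A (λ (a , b) → trans
               (solve 5 (λ q t p x y → t :* (t :* q) :* (x :* (q :* p :* y)) := q :* (q :* p) :* (t :* x :* (t :* y)))
                 refl q t (q ^ b) (X a 0) (X b 0))
               (*-congˡ (*-cong (sym (F-X a)) (sym (F-X b))))) ⟩
        ∑ A (λ (a , b) → q ^ suc (suc b) * (F (suc a) 0 * F (suc b) 0)) ∎) ⟩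
    (q + t) * F (suc (suc n)) 0 + ∑ A (λ (a , b) → q ^ suc (suc b) * (F (suc a) 0 * F (suc b) 0)) ∎
    where A = antidiagonal n

-- Words of natural numbers

lookup-injective : ∀ {w : List ℕ} → Unique w → ∀ {i j} → List.lookup w i ≡ List.lookup w j → i ≡ j
lookup-injective (x∉ ∷ u) {fzero}  {fzero}  eq = ≡.refl
lookup-injective {x ∷ w} (x∉ ∷ u) {fzero}  {fsuc j} eq = contradiction eq (All.lookup x∉ (∈-lookup {xs = w} j))
lookup-injective {x ∷ w} (x∉ ∷ u) {fsuc i} {fzero}  eq = contradiction (≡.sym eq) (All.lookup x∉ (∈-lookup {xs = w} i))
lookup-injective (x∉ ∷ u) {fsuc i} {fsuc j} eq = ≡.cong fsuc (lookup-injective u eq)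

pigeonhole : ∀ {b w} → Unique w → All (_< b) w → length w ≤ b
pigeonhole {b} {w} u <b = injective⇒≤ {f = f} λ eq → lookup-injective u (fromℕ<-injective _ _ _ _ eq)
  where
  f : Fin (length w) → Fin b
  f i = fromℕ< (All.lookup <b (∈-lookup {xs = w} i))

-- Putting the letters 0, ..., a - 1 in front of `w` reduces this to `pigeonhole`.
pigeonhole-interval : ∀ {a b w} → Unique w → All (a ≤_) w → All (_< b) w → a ≤ b → a +ℕ length w ≤ b
pigeonhole-interval {a} {b} {w} u a≤ <b a≤b = begin
  a +ℕ length w                ≡⟨ ≡.cong (_+ℕ length w) (length-upTo a) ⟨
  length (upTo a) +ℕ length w  ≡⟨ length-++ (upTo a) ⟨
  length (upTo a ++ w)        ≤⟨ pigeonhole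
    (AllPairs.++⁺ (Unique.upTo⁺ a) u (All.map (λ x<a → All.map (λ a≤y → ℕ.<⇒≢ (ℕ.<-≤-trans x<a a≤y)) a≤) (All.all-upTo a)))
    (All.++⁺ (All.map (λ x<a → ℕ.<-≤-trans x<a a≤b) (All.all-upTo a)) <b) ⟩
  b                           ∎
  where open ℕ.≤-Reasoning

-- The recursive form makes deletion of the first letter a projection.
AllTriples : (ℕ → ℕ → ℕ → Set) → List ℕ → Set
AllTriples R []      = ⊤
AllTriples R (x ∷ w) = AllPairs (R x) w × AllTriples R w

allTriples? : ∀ {R} → (∀ x y z → Dec (R x y z)) → ∀ w → Dec (AllTriples R w)
allTriples? R? []      = yes tt
allTriples? R? (x ∷ w) = AllPairs.allPairs? (R? x) w ×-dec allTriples? R? w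

No231 No321 : ℕ → ℕ → ℕ → Set
No231 x y z = ¬ (z < x × x < y)
No321 x y z = ¬ (z < y × y < x)

no231? : ∀ x y z → Dec (No231 x y z)
no231? x y z = ¬? ((z ℕ.<? x) ×-dec (x ℕ.<? y))

no321? : ∀ x y z → Dec (No321 x y z)
no321? x y z = ¬? ((z ℕ.<? y) ×-dec (y ℕ.<? x))

⟦_⟧ : Bool → ℕ
⟦ true ⟧  = 1
⟦ false ⟧ = 0

tally : (ℕ → Bool) → List ℕ → ℕ
tally p []      = 0
tally p (x ∷ w) = ⟦ p x ⟧ +ℕ tally p w

inversions : List ℕ → ℕ
inversions []      = 0
inversions (x ∷ w) = tally (_<ᵇ x) w +ℕ inversions w

descents : List ℕ → ℕ
descents (x ∷ y ∷ w) = ⟦ y <ᵇ x ⟧ +ℕ descents (y ∷ w)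
descents _           = 0

vincular : List ℕ → ℕ
vincular (x ∷ y ∷ w) = tally (λ z → (x <ᵇ z) ∧ (z <ᵇ y)) w +ℕ vincular (y ∷ w)
vincular _           = 0

-- The flag tells whether the first letter is preceded by a larger one.
doubleDescents : Bool → List ℕ → ℕ
doubleDescents b (x ∷ y ∷ w) = ⟦ b ∧ (y <ᵇ x) ⟧ +ℕ doubleDescents (y <ᵇ x) (y ∷ w)
doubleDescents b _           = 0

<ᵇ-true : ∀ {x y} → x < y → (x <ᵇ y) ≡ true
<ᵇ-true {x} {y} = dec-true (x ℕ.<? y)

<ᵇ-false : ∀ {x y} → ¬ (x < y) → (x <ᵇ y) ≡ false
<ᵇ-false {x} {y} = dec-false (x ℕ.<? y)

tally-cong : ∀ {p r w} → All (λ x → p x ≡ r x) w → tally p w ≡ tally r w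
tally-cong []        = ≡.refl
tally-cong (eq ∷ eqs) = ≡.cong₂ _+ℕ_ (≡.cong ⟦_⟧ eq) (tally-cong eqs)

tally-map : ∀ p (e : ℕ → ℕ) w → tally p (map e w) ≡ tally (p ∘ e) w
tally-map p e []      = ≡.refl
tally-map p e (x ∷ w) = ≡.cong (_ +ℕ_) (tally-map p e w)

tally-++ : ∀ p v w → tally p (v ++ w) ≡ tally p v +ℕ tally p w
tally-++ p []      w = ≡.refl
tally-++ p (x ∷ v) w = ≡.trans (≡.cong (_ +ℕ_) (tally-++ p v w)) (≡.sym (ℕ.+-assoc ⟦ p x ⟧ _ _))

tally-all : ∀ {p w} → All (λ x → p x ≡ true) w → tally p w ≡ length w
tally-all []         = ≡.refl
tally-all (eq ∷ eqs) rewrite eq = ≡.cong suc (tally-all eqs)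

tally-none : ∀ {p w} → All (λ x → p x ≡ false) w → tally p w ≡ 0
tally-none []         = ≡.refl
tally-none (eq ∷ eqs) rewrite eq = tally-none eqs

-- Invariance of patterns and statistics under order embeddings

OrderEmbedding : (ℕ → ℕ) → Set
OrderEmbedding e = ∀ x y → (e x <ᵇ e y) ≡ (x <ᵇ y)

module _ {e : ℕ → ℕ} (emb : OrderEmbedding e) where

  <-preserved : ∀ {x y} → x < y → e x < e y
  <-preserved {x} {y} x<y with e x ℕ.<? e y
  ... | yes p = p
  ... | no ¬p with () ← ≡.trans (≡.sym (<ᵇ-false ¬p)) (≡.trans (emb x y) (<ᵇ-true x<y))

  <-reflected : ∀ {x y} → e x < e y → x < y
  <-reflected {x} {y} ex<ey with x ℕ.<? y
  ... | yes p = p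
  ... | no ¬p with () ← ≡.trans (≡.sym (<ᵇ-true ex<ey)) (≡.trans (emb x y) (<ᵇ-false ¬p))

  embedding-injective : ∀ {x y} → e x ≡ e y → x ≡ y
  embedding-injective {x} {y} eq with ℕ.<-cmp x y
  ... | tri< x<y _ _ = contradiction eq (ℕ.<⇒≢ (<-preserved x<y))
  ... | tri≈ _ x≡y _ = x≡y
  ... | tri> _ _ y<x = contradiction (≡.sym eq) (ℕ.<⇒≢ (<-preserved y<x))

  unique-map : ∀ {w} → Unique w ⇔ Unique (map e w)
  unique-map = mk⇔ (Unique.map⁺ embedding-injective) Unique.map⁻

  allTriples-map : ∀ {R} → (∀ x y z → R x y z ⇔ R (e x) (e y) (e z)) → ∀ w → AllTriples R w ⇔ AllTriples R (map e w)
  allTriples-map R⇔ w = mk⇔ (to w) (from w)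
    where
    to : ∀ w → AllTriples _ w → AllTriples _ (map e w)
    to []      _        = tt
    to (x ∷ w) (p , ps) = AllPairs.map⁺ (AllPairs.map (λ {y} {z} → Equivalence.to (R⇔ x y z)) p) , to w ps
    from : ∀ w → AllTriples _ (map e w) → AllTriples _ w
    from []      _        = tt
    from (x ∷ w) (p , ps) = AllPairs.map (λ {y} {z} → Equivalence.from (R⇔ x y z)) (AllPairs.map⁻ p) , from w ps

  no231-map : ∀ x y z → No231 x y z ⇔ No231 (e x) (e y) (e z)
  no231-map x y z = mk⇔ (λ f (p , r) → f (<-reflected p , <-reflected r)) (λ f (p , r) → f (<-preserved p , <-preserved r))

  no321-map : ∀ x y z → No321 x y z ⇔ No321 (e x) (e y) (e z)
  no321-map x y z = mk⇔ (λ f (p , r) → f (<-reflected p , <-reflected r)) (λ f (p , r) → f (<-preserved p , <-preserved r))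

  tally-<-map : ∀ x w → tally (_<ᵇ e x) (map e w) ≡ tally (_<ᵇ x) w
  tally-<-map x w = ≡.trans (tally-map _ e w) (tally-cong (All.universal (λ y → emb y x) w))

  inversions-map : ∀ w → inversions (map e w) ≡ inversions w
  inversions-map []      = ≡.refl
  inversions-map (x ∷ w) = ≡.cong₂ _+ℕ_ (tally-<-map x w) (inversions-map w)

  descents-map : ∀ w → descents (map e w) ≡ descents w
  descents-map []          = ≡.refl
  descents-map (x ∷ [])    = ≡.refl
  descents-map (x ∷ y ∷ w) = ≡.cong₂ _+ℕ_ (≡.cong ⟦_⟧ (emb y x)) (descents-map (y ∷ w))

  vincular-map : ∀ w → vincular (map e w) ≡ vincular w
  vincular-map []          = ≡.refl
  vincular-map (x ∷ [])    = ≡.refl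
  vincular-map (x ∷ y ∷ w) = ≡.cong₂ _+ℕ_
    (≡.trans (tally-map _ e w) (tally-cong (All.universal (λ z → ≡.cong₂ _∧_ (emb x z) (emb z y)) w)))
    (vincular-map (y ∷ w))

  doubleDescents-map : ∀ b w → doubleDescents b (map e w) ≡ doubleDescents b w
  doubleDescents-map b []          = ≡.refl
  doubleDescents-map b (x ∷ [])    = ≡.refl
  doubleDescents-map b (x ∷ y ∷ w) = ≡.trans
    (≡.cong (λ c → ⟦ b ∧ c ⟧ +ℕ doubleDescents c (map e (y ∷ w))) (emb y x))
    (≡.cong (_ +ℕ_) (doubleDescents-map (y <ᵇ x) (y ∷ w)))

+-embedding : ∀ a → OrderEmbedding (a +ℕ_)
+-embedding zero    x y = ≡.refl
+-embedding (suc a) x y = +-embedding a x y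

-- Cutting a 231-avoiding word at its maximum

AllPairs-++⁻ : ∀ {R : ℕ → ℕ → Set} v {w} → AllPairs R (v ++ w) → AllPairs R v × AllPairs R w
AllPairs-++⁻ []      ps       = [] , ps
AllPairs-++⁻ (x ∷ v) (p ∷ ps) with AllPairs-++⁻ v ps
... | pv , pw = All.++⁻ˡ v p ∷ pv , pw

Below : List ℕ → List ℕ → Set
Below v w = All (λ x → All (x <_) w) v

module _ {n : ℕ} where

  split-at-max : ∀ v {w} → All (_< n) v → Unique (v ++ n ∷ w) → AllTriples No231 (v ++ n ∷ w) →
    (Unique v × Unique w) × (AllTriples No231 v × AllTriples No231 w) × Below v w
  split-at-max []      _ (_ ∷ u) (_ , ts) = ([] , u) , (tt , ts) , []
  split-at-max (x ∷ v) {w} (x<n ∷ v<n) (x∉ ∷ u) (t , ts)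
    with split-at-max v v<n u ts | AllPairs-++⁻ v t
  ... | (uv , uw) , (tv , tw) , v<w | tx , (t′ ∷ _) =
    (All.++⁻ˡ v x∉ ∷ uv , uw) , ((tx , tv) , tw) , All.zipWith x<z (t′ , All.tail (All.++⁻ʳ v x∉)) ∷ v<w
    where
    x<z : ∀ {z} → No231 x n z × (x ≢ z) → x < z
    x<z {z} (avoid , x≢z) = ℕ.≤∧≢⇒< (ℕ.≮⇒≥ (λ z<x → avoid (z<x , x<n))) x≢z

  -- A 231 starting in `v` ends with a letter smaller than its first, and no such letter occurs in
  -- `n ∷ w`; a 231 starting with `n` would need a letter above `n`.
  join-at-max : ∀ v {w} → All (_< n) v → All (_< n) w → Unique v × Unique w →
    AllTriples No231 v × AllTriples No231 w → Below v w → Unique (v ++ n ∷ w) × AllTriples No231 (v ++ n ∷ w)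
  join-at-max []      {w} _ w<n (_ , uw) (_ , tw) _ =
    (All.map (λ z<n n≡z → ℕ.<⇒≢ z<n (≡.sym n≡z)) w<n ∷ uw) , (pairs w<n , tw)
    where
    pairs : ∀ {w} → All (_< n) w → AllPairs (No231 n) w
    pairs []          = []
    pairs (y<n ∷ w<n) = All.universal (λ z (_ , n<y) → ℕ.<-asym n<y y<n) _ ∷ pairs w<n
  join-at-max (x ∷ v) {w} (x<n ∷ v<n) w<n (x∉ ∷ uv , uw) ((tx , tv) , tw) (x<w ∷ v<w)
    with join-at-max v v<n w<n (uv , uw) (tv , tw) v<w
  ... | u , t =
    All.++⁺ x∉ (All.map ℕ.<⇒≢ (x<n ∷ x<w)) ∷ u ,
    (AllPairs.++⁺ tx (pairs (x<n ∷ x<w)) (All.universal (λ _ → All.map avoid (x<n ∷ x<w)) v) , t)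
    where
    avoid : ∀ {y z} → x < z → No231 x y z
    avoid x<z (z<x , _) = ℕ.<-asym x<z z<x
    pairs : ∀ {w} → All (x <_) w → AllPairs (No231 x) w
    pairs []        = []
    pairs (p ∷ ps)  = All.map avoid ps ∷ pairs ps

  -- The maximum acts as the large boundary value for both factors: it protects the last letter of
  -- `x ∷ v` and gives `w` the initial flag `true`. It is reached by an ascent and so is no double
  -- descent itself.
  doubleDescents-at-max : ∀ b x v {w} → All (_< n) (x ∷ v) → All (_< n) w →
    doubleDescents b (x ∷ v ++ n ∷ w) ≡ doubleDescents b (x ∷ v) +ℕ doubleDescents true w
  doubleDescents-at-max false x [] {[]} (x<n ∷ _) _ = ≡.refl
  doubleDescents-at-max true x [] {[]} (x<n ∷ _) _ rewrite <ᵇ-false (ℕ.<-asym x<n) = ≡.refl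
  doubleDescents-at-max false x [] {y ∷ w} (x<n ∷ _) (y<n ∷ _) rewrite <ᵇ-false (ℕ.<-asym x<n) | <ᵇ-true y<n = ≡.refl
  doubleDescents-at-max true x [] {y ∷ w} (x<n ∷ _) (y<n ∷ _) rewrite <ᵇ-false (ℕ.<-asym x<n) | <ᵇ-true y<n = ≡.refl
  doubleDescents-at-max b x (y ∷ v) (_ ∷ v<n) w<n =
    ≡.trans (≡.cong (_ +ℕ_) (doubleDescents-at-max (y <ᵇ x) y v v<n w<n)) (≡.sym (ℕ.+-assoc ⟦ b ∧ (y <ᵇ x) ⟧ _ _))

  descents-at-max : ∀ x v {w} → All (_< n) (x ∷ v) →
    descents (x ∷ v ++ n ∷ w) ≡ descents (x ∷ v) +ℕ descents (n ∷ w)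
  descents-at-max x []      (x<n ∷ _) rewrite <ᵇ-false (ℕ.<-asym x<n) = ≡.refl
  descents-at-max x (y ∷ v) (_ ∷ v<n) =
    ≡.trans (≡.cong (_ +ℕ_) (descents-at-max y v v<n)) (≡.sym (ℕ.+-assoc ⟦ y <ᵇ x ⟧ _ _))

  vincular-max : ∀ {w} → All (_< n) w → vincular (n ∷ w) ≡ vincular w
  vincular-max []            = ≡.refl
  vincular-max (_∷_ {y} {w} y<n w<n) = ≡.cong (_+ℕ vincular (y ∷ w))
    (tally-none (All.map (λ {z} z<n → ≡.cong (_∧ (z <ᵇ y)) (<ᵇ-false (ℕ.<-asym z<n))) w<n))

  -- For two adjacent letters before the maximum, `n` and all of `w` are too large to lie between
  -- them. The ascent to `n` has all of `w` between its ends, and the step from `n` to `w` is no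
  -- ascent.
  vincular-at-max : ∀ x v {w} → All (_< n) (x ∷ v) → All (_< n) w → Below (x ∷ v) w →
    vincular (x ∷ v ++ n ∷ w) ≡ vincular (x ∷ v) +ℕ (length w +ℕ vincular w)
  vincular-at-max x [] {w} _ w<n (x<w ∷ _) = ≡.cong₂ _+ℕ_
    (tally-all (All.zipWith (λ (x<z , z<n) → ≡.cong₂ _∧_ (<ᵇ-true x<z) (<ᵇ-true z<n)) (x<w , w<n)))
    (vincular-max w<n)
  vincular-at-max x (y ∷ v) {w} (_ ∷ y<n ∷ v<n) w<n (_ ∷ y<w ∷ v<w) = begin
    tally p (v ++ n ∷ w) +ℕ vincular (y ∷ v ++ n ∷ w)
      ≡⟨ ≡.cong₂ _+ℕ_ (tally-++ p v (n ∷ w)) (vincular-at-max y v (y<n ∷ v<n) w<n (y<w ∷ v<w)) ⟩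
    tally p v +ℕ tally p (n ∷ w) +ℕ (vincular (y ∷ v) +ℕ (length w +ℕ vincular w))
      ≡⟨ ≡.cong (λ k → tally p v +ℕ k +ℕ (vincular (y ∷ v) +ℕ (length w +ℕ vincular w))) (tally-none (All.map large (y<n ∷ y<w))) ⟩
    tally p v +ℕ 0 +ℕ (vincular (y ∷ v) +ℕ (length w +ℕ vincular w))
      ≡⟨ ≡.cong (_+ℕ _) (ℕ.+-identityʳ (tally p v)) ⟩
    tally p v +ℕ (vincular (y ∷ v) +ℕ (length w +ℕ vincular w))
      ≡⟨ ℕ.+-assoc (tally p v) _ _ ⟨
    tally p v +ℕ vincular (y ∷ v) +ℕ (length w +ℕ vincular w) ∎
    where
    open ≡.≡-Reasoning
    p : ℕ → Bool
    p z = (x <ᵇ z) ∧ (z <ᵇ y)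
    large : ∀ {z} → y < z → p z ≡ false
    large {z} y<z rewrite <ᵇ-false (ℕ.<-asym y<z) with x <ᵇ z
    ... | true  = ≡.refl
    ... | false = ≡.refl

-- Above each letter x of `v` there must be room for the b letters of `w`, so x < a. Below each
-- letter of `w` there must be room for the a letters of `v`.
split-bounds : ∀ {a b v w} → length v ≡ a → length w ≡ b → All (_< a +ℕ b) v → All (_< a +ℕ b) w →
  Unique v → Unique w → Below v w → All (_< a) v × All (a ≤_) w
split-bounds {a} {b} {v} {w} ≡.refl ≡.refl v<n w<n uv uw v<w =
  All.zipWith (λ (x<n , x<w) → ℕ.+-cancelʳ-≤ (length w) _ a (pigeonhole-interval uw x<w w<n x<n)) (v<n , v<w) ,
  All.tabulate (λ z∈w → pigeonhole uv (All.map (λ x<w → All.lookup x<w z∈w) v<w))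

-- Without double descents, every descent is immediately preceded by an ascent.
descents-bound : ∀ x w → doubleDescents true (x ∷ w) ≡ 0 → ∃ λ e → length w ≡ descents (x ∷ w) +ℕ descents (x ∷ w) +ℕ e
-- The left side here counts `x` too, since after an ascent `x` can still be the top of a descent.
-- Each descent uses up its top and its bottom, and `e` counts the letters left over.
descents-bound-asc : ∀ x w → doubleDescents false (x ∷ w) ≡ 0 → ∃ λ e → suc (length w) ≡ descents (x ∷ w) +ℕ descents (x ∷ w) +ℕ e

descents-bound x []      eq = 0 , ≡.refl
descents-bound x (y ∷ w) eq with y <ᵇ x
... | false = descents-bound-asc y w eq

descents-bound-asc x []      eq = 1 , ≡.refl
descents-bound-asc x (y ∷ w) eq with y <ᵇ x
... | true  with descents-bound y w eq
...   | e , len = e , ≡.trans (≡.cong (λ k → suc (suc k)) len) (≡.cong suc (≡.cong (_+ℕ e) (≡.sym (ℕ.+-suc _ _))))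
descents-bound-asc x (y ∷ w) eq | false with descents-bound-asc y w eq
...   | e , len = suc e , ≡.trans (≡.cong suc len) (≡.sym (ℕ.+-suc _ e))

-- 231-avoiding words without double descents

unique? : (w : List ℕ) → Dec (Unique w)
unique? = AllPairs.allPairs? (λ x y → ¬? (x ℕ.≟ y))

Valid231 : List ℕ → Set
Valid231 w = Unique w × AllTriples No231 w × doubleDescents true w ≡ 0

valid231? : ∀ w → Dec (Valid231 w)
valid231? w = unique? w ×-dec (allTriples? {No231} no231? w ×-dec (doubleDescents true w ℕ.≟ 0))

unique-twice : ∀ v {n : ℕ} {w} → n ∈ w → ¬ Unique (v ++ n ∷ w)
unique-twice []      n∈w (n∉ ∷ _) = All.lookup n∉ n∈w ≡.refl
unique-twice (x ∷ v) n∈w (_ ∷ u)  = unique-twice v n∈w u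

max-∈ : ∀ {n w} → All (_< suc n) w → ¬ All (_< n) w → n ∈ w
max-∈ [] ¬all = contradiction [] ¬all
max-∈ {n} (_∷_ {x} x≤n w≤n) ¬all with x ℕ.<? n
... | yes x<n = there (max-∈ w≤n (λ all → ¬all (x<n ∷ all)))
... | no x≮n  = here (ℕ.≤-antisym (ℕ.≮⇒≥ x≮n) (ℕ.≤-pred x≤n))

valid231-at-max : ∀ {a b} x v {w} → All (_< a) (x ∷ v) → All (_< b) w →
  Valid231 ((x ∷ v) ++ (a +ℕ b) ∷ map (a +ℕ_) w) ⇔ (Valid231 (x ∷ v) × Valid231 w)
valid231-at-max {a} {b} x v {w} v<a w<b = mk⇔ to from
  where
  v<n : All (_< a +ℕ b) (x ∷ v)
  v<n = All.map (λ y<a → ℕ.<-≤-trans y<a (ℕ.m≤m+n a b)) v<a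
  w<n : All (_< a +ℕ b) (map (a +ℕ_) w)
  w<n = All.map⁺ (All.map (ℕ.+-monoʳ-< a) w<b)
  v<w : Below (x ∷ v) (map (a +ℕ_) w)
  v<w = All.map (λ y<a → All.map⁺ (All.universal (λ z → ℕ.<-≤-trans y<a (ℕ.m≤m+n a z)) w)) v<a
  emb = +-embedding a
  dd : doubleDescents true ((x ∷ v) ++ (a +ℕ b) ∷ map (a +ℕ_) w) ≡ doubleDescents true (x ∷ v) +ℕ doubleDescents true w
  dd = ≡.trans (doubleDescents-at-max true x v v<n w<n) (≡.cong (_ +ℕ_) (doubleDescents-map emb true w))
  to : _ → _
  to (u , ts , d) with split-at-max (x ∷ v) v<n u ts
  ... | (uv , uw) , (tv , tw) , _ =
    (uv , tv , ℕ.m+n≡0⇒m≡0 _ d′) ,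
    (Equivalence.from (unique-map emb) uw , Equivalence.from (allTriples-map emb (no231-map emb) w) tw , ℕ.m+n≡0⇒n≡0 (doubleDescents true (x ∷ v)) d′)
    where d′ = ≡.trans (≡.sym dd) d
  from : _ → _
  from ((uv , tv , dv) , (uw , tw , dw)) with join-at-max (x ∷ v) v<n w<n
    (uv , Equivalence.to (unique-map emb) uw) (tv , Equivalence.to (allTriples-map emb (no231-map emb) w) tw) v<w
  ... | u , ts = u , ts , ≡.trans dd (≡.cong₂ _+ℕ_ dv dw)

module Patterns231 {c ℓ} (R : CommutativeRing c ℓ) (t q : CommutativeRing.Carrier R) where
  open CommutativeRing R hiding (zero)
  open SumsAndPowers R
  open Sums R
  open import Relation.Binary.Reasoning.Setoid setoid
  open import Algebra.Properties.Semiring.Exp semiring using (^-homo-*; ^-congʳ)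
  open import Algebra.Solver.Ring.NaturalCoefficients.Default commutativeSemiring using (solve; _:=_; _:*_; con)

  -- Words are cut at the first `n`; the two hypotheses discard words without `n` and words with a
  -- second one. The induction removes a first letter `x` below `n`, which changes the summand to
  -- `f ∘ (x ∷_)`; hence the general `f`.
  ∑-split-at-max : ∀ n l f →
    (∀ w → length w ≡ suc l → All (_< n) w → f w ≈ 0#) →
    (∀ v w → n ∈ w → f (v ++ n ∷ w) ≈ 0#) →
    ∑ (wordsℕ (suc n) (suc l)) f ≈
    ∑ (antidiagonal l) (λ (a , b) → ∑ (wordsℕ n a) (λ v → ∑ (wordsℕ n b) (λ w → f (v ++ n ∷ w))))
  ∑-split-at-max n l f none twice = begin
    ∑ (wordsℕ (suc n) (suc l)) f
      ≈⟨ ∑-wordsℕ-suc (suc n) l f ⟩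
    ∑ (upTo (suc n)) (λ x → ∑ (wordsℕ (suc n) l) (f ∘ (x ∷_)))
      ≈⟨ ∑<-last n _ ⟩
    ∑ (upTo n) (λ x → ∑ (wordsℕ (suc n) l) (f ∘ (x ∷_))) + ∑ (wordsℕ (suc n) l) (f ∘ (n ∷_))
      ≈⟨ +-congˡ first ⟩
    ∑ (upTo n) (λ x → ∑ (wordsℕ (suc n) l) (f ∘ (x ∷_))) + ∑ (wordsℕ n l) (f ∘ (n ∷_))
      ≈⟨ rest l none ⟩
    ∑ (antidiagonal l) (λ (a , b) → ∑ (wordsℕ n a) (λ v → ∑ (wordsℕ n b) (λ w → f (v ++ n ∷ w)))) ∎
    where
    first : ∑ (wordsℕ (suc n) l) (f ∘ (n ∷_)) ≈ ∑ (wordsℕ n l) (f ∘ (n ∷_))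
    first = begin
      ∑ (wordsℕ (suc n) l) (f ∘ (n ∷_))
        ≈⟨ ∑-cong-∈ (wordsℕ (suc n) l) (λ w∈ → only (proj₂ (∈-wordsℕ⁻ l w∈))) ⟩
      ∑ (wordsℕ (suc n) l) (λ w → [ all? (ℕ._<? n) w ] * f (n ∷ w))
        ≈⟨ ∑-wordsℕ-embed (ℕ._<? n) (suc n) n id (λ g → ≡.subst (λ m → ∑ (upTo m) (λ x → [ x ℕ.<? n ] * g x) ≈ ∑ (upTo n) g) (ℕ.+-comm n 1) (∑<-below n 1 g)) l _ ⟩
      ∑ (wordsℕ n l) (λ w → f (n ∷ map id w))
        ≈⟨ ∑-cong (wordsℕ n l) (λ w → reflexive (≡.cong (f ∘ (n ∷_)) (map-id w))) ⟩
      ∑ (wordsℕ n l) (f ∘ (n ∷_)) ∎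
      where
      only : ∀ {w} → All (_< suc n) w → f (n ∷ w) ≈ [ all? (ℕ._<? n) w ] * f (n ∷ w)
      only {w} w≤n with all? (ℕ._<? n) w
      ... | yes _   = sym (*-identityˡ _)
      ... | no ¬all = trans (twice [] w (max-∈ w≤n ¬all)) (sym (zeroˡ _))
    T : ℕ × ℕ → Carrier
    T (a , b) = ∑ (wordsℕ n a) (λ v → ∑ (wordsℕ n b) (λ w → f (v ++ n ∷ w)))
    rest : ∀ l → (∀ w → length w ≡ suc l → All (_< n) w → f w ≈ 0#) →
      ∑ (upTo n) (λ x → ∑ (wordsℕ (suc n) l) (f ∘ (x ∷_))) + ∑ (wordsℕ n l) (f ∘ (n ∷_)) ≈ ∑ (antidiagonal l) T
    rest zero none = trans
      (+-congʳ (trans (∑-cong-∈ (upTo n) (λ x∈ → trans (+-identityʳ _) (none _ ≡.refl (∈-upTo⁻ x∈ ∷ [])))) (∑-zero (upTo n))))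
      (trans (+-identityˡ _) (sym (trans (+-identityʳ _) (+-identityʳ _))))
    rest (suc l) none = begin
      ∑ (upTo n) (λ x → ∑ (wordsℕ (suc n) (suc l)) (f ∘ (x ∷_))) + ∑ (wordsℕ n (suc l)) (f ∘ (n ∷_))
        ≈⟨ +-cong (∑-cong-∈ (upTo n) (λ {x} x∈ → ∑-split-at-max n l (f ∘ (x ∷_))
             (λ w len w<n → none (x ∷ w) (≡.cong suc len) (∈-upTo⁻ x∈ ∷ w<n)) (λ v w → twice (x ∷ v) w)))
             (sym (+-identityʳ _)) ⟩
      ∑ (upTo n) (λ x → ∑ (antidiagonal l) (λ (a , b) → ∑ (wordsℕ n a) (λ v → ∑ (wordsℕ n b) (λ w → f (x ∷ v ++ n ∷ w)))))
        + T (0 , suc l)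
        ≈⟨ +-congʳ (∑-comm (upTo n) (antidiagonal l) _) ⟩
      ∑ (antidiagonal l) (λ (a , b) → ∑ (upTo n) (λ x → ∑ (wordsℕ n a) (λ v → ∑ (wordsℕ n b) (λ w → f (x ∷ v ++ n ∷ w)))))
        + T (0 , suc l)
        ≈⟨ +-congʳ (∑-cong (antidiagonal l) (λ (a , b) → ∑-wordsℕ-suc n a _)) ⟨
      ∑ (antidiagonal l) (λ (a , b) → T (suc a , b)) + T (0 , suc l)
        ≈⟨ +-comm _ _ ⟩
      T (0 , suc l) + ∑ (antidiagonal l) (λ (a , b) → T (suc a , b))
        ≈⟨ ∑-antidiagonal-suc l T ⟨
      ∑ (antidiagonal (suc l)) T ∎

  -- With k = d + 1, of the factor q^{n-k} the power q^{n+1-2k} clears the denominators and q^d is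
  -- left. On nonempty valid words `descents-bound` makes the truncated subtraction exact.
  weight231 : List ℕ → Carrier
  weight231 w = t ^ suc d * q ^ d * (q + t) ^ (length w ∸ suc (d +ℕ d)) * q ^ vincular w
    where d = descents w

  G : List ℕ → Carrier
  G w = [ valid231? w ] * weight231 w

  G-zero : ∀ w → ¬ Valid231 w → G w ≈ 0#
  G-zero w ¬v = trans (*-congʳ ([]-false (valid231? w) ¬v)) (zeroˡ _)

  weight231-value : ∀ w {d e v} → descents w ≡ d → length w ≡ suc (d +ℕ d +ℕ e) → vincular w ≡ v →
    weight231 w ≈ t ^ suc d * q ^ d * (q + t) ^ e * q ^ v
  weight231-value w {e = e} ≡.refl len ≡.refl = *-congʳ (*-congˡ (^-congʳ (q + t)
    (≡.trans (≡.cong (_∸ suc (d +ℕ d)) len) (ℕ.m+n∸m≡n (d +ℕ d) e))))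
    where d = descents w

  module _ {a b : ℕ} {x v} (v<a : All (_< a) (x ∷ v)) where

    private
      v<n : All (_< a +ℕ b) (x ∷ v)
      v<n = All.map (λ y<a → ℕ.<-≤-trans y<a (ℕ.m≤m+n a b)) v<a

    -- A maximum in last position contributes a double ascent.
    G-max-last : b ≡ 0 → G ((x ∷ v) ++ (a +ℕ b) ∷ []) ≈ (q + t) * G (x ∷ v)
    G-max-last ≡.refl = begin
      [ valid231? (x ∷ v ++ n ∷ []) ] * weight231 (x ∷ v ++ n ∷ [])
        ≈⟨ *-congʳ ([]-⇔ valid⇔ (valid231? (x ∷ v ++ n ∷ [])) (valid231? (x ∷ v))) ⟩
      [ valid231? (x ∷ v) ] * weight231 (x ∷ v ++ n ∷ [])
        ≈⟨ []-cong (valid231? (x ∷ v)) (λ (_ , _ , dd) → weights (descents-bound x v dd)) ⟩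
      [ valid231? (x ∷ v) ] * ((q + t) * weight231 (x ∷ v))
        ≈⟨ solve 3 (λ i u w → i :* (u :* w) := u :* (i :* w)) refl _ _ _ ⟩
      (q + t) * G (x ∷ v) ∎
      where
      n = a +ℕ b
      open Equivalence (valid231-at-max {b = b} x v {[]} v<a [])
      valid⇔ : Valid231 (x ∷ v ++ n ∷ []) ⇔ Valid231 (x ∷ v)
      valid⇔ = mk⇔ (proj₁ ∘ to) (λ valid → from (valid , [] , tt , ≡.refl))
      d = descents (x ∷ v)
      weights : (∃ λ e → length v ≡ d +ℕ d +ℕ e) → weight231 (x ∷ v ++ n ∷ []) ≈ (q + t) * weight231 (x ∷ v)
      weights (e , len) = begin
        weight231 (x ∷ v ++ n ∷ [])
          ≈⟨ weight231-value (x ∷ v ++ n ∷ []) (≡.trans (descents-at-max x v v<n) (ℕ.+-identityʳ d))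
               (≡.cong suc (≡.trans (length-++ v) (≡.trans (ℕ.+-comm (length v) 1)
                 (≡.trans (≡.cong suc len) (≡.sym (ℕ.+-suc (d +ℕ d) e))))))
               (≡.trans (vincular-at-max x v v<n [] (All.universal (λ _ → []) (x ∷ v))) (ℕ.+-identityʳ _)) ⟩
        t ^ suc d * q ^ d * (q + t) ^ suc e * q ^ vincular (x ∷ v)
          ≈⟨ solve 4 (λ u a p r → a :* (u :* p) :* r := u :* (a :* p :* r)) refl (q + t) _ _ _ ⟩
        (q + t) * (t ^ suc d * q ^ d * (q + t) ^ e * q ^ vincular (x ∷ v))
          ≈⟨ *-congˡ (weight231-value (x ∷ v) ≡.refl (≡.cong suc len) ≡.refl) ⟨
        (q + t) * weight231 (x ∷ v) ∎

    -- The descent after the maximum gives d = d₁ + 1 + d₂. Thus t^{d+1} splits evenly, q^d has one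
    -- q to spare, and the exponents of q + t add up, as the maximum and the extra 1 of a length
    -- account for the new descent. The other b factors q come from (13-2).
    G-max-inner : ∀ {y w} → length (y ∷ w) ≡ b → All (_< b) (y ∷ w) →
      G ((x ∷ v) ++ (a +ℕ b) ∷ map (a +ℕ_) (y ∷ w)) ≈ q ^ suc b * (G (x ∷ v) * G (y ∷ w))
    G-max-inner {y} {w} lenw w<b = begin
      [ valid231? z ] * weight231 z
        ≈⟨ *-congʳ ([]-⇔ (valid231-at-max {b = b} x v v<a w<b) (valid231? z) (valid231? (x ∷ v) ×-dec valid231? (y ∷ w))) ⟩
      [ valid231? (x ∷ v) ×-dec valid231? (y ∷ w) ] * weight231 z
        ≈⟨ []-cong (valid231? (x ∷ v) ×-dec valid231? (y ∷ w))
             (λ ((_ , _ , ddv) , (_ , _ , ddw)) → weights (descents-bound x v ddv) (descents-bound y w ddw)) ⟩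
      [ valid231? (x ∷ v) ×-dec valid231? (y ∷ w) ] * (q ^ suc b * (weight231 (x ∷ v) * weight231 (y ∷ w)))
        ≈⟨ *-congʳ (ι-∧ (does (valid231? (x ∷ v))) _) ⟩
      [ valid231? (x ∷ v) ] * [ valid231? (y ∷ w) ] * (q ^ suc b * (weight231 (x ∷ v) * weight231 (y ∷ w)))
        ≈⟨ solve 5 (λ i j p v w → i :* j :* (p :* (v :* w)) := p :* ((i :* v) :* (j :* w))) refl _ _ _ _ _ ⟩
      q ^ suc b * (G (x ∷ v) * G (y ∷ w)) ∎
      where
      n = a +ℕ b
      z = x ∷ v ++ n ∷ map (a +ℕ_) (y ∷ w)
      d₁ = descents (x ∷ v)
      d₂ = descents (y ∷ w)
      v₁ = vincular (x ∷ v)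
      v₂ = vincular (y ∷ w)
      w<n : All (_< n) (map (a +ℕ_) (y ∷ w))
      w<n = All.map⁺ (All.map (ℕ.+-monoʳ-< a) w<b)
      v<w : Below (x ∷ v) (map (a +ℕ_) (y ∷ w))
      v<w = All.map (λ y<a → All.map⁺ (All.universal (λ z → ℕ.<-≤-trans y<a (ℕ.m≤m+n a z)) (y ∷ w))) v<a
      emb = +-embedding a
      des-z : descents z ≡ d₁ +ℕ suc d₂
      des-z = ≡.trans (descents-at-max x v v<n) (≡.cong (d₁ +ℕ_) (≡.cong₂ _+ℕ_
        (≡.cong ⟦_⟧ (<ᵇ-true (ℕ.+-monoʳ-< a (All.head w<b)))) (descents-map emb (y ∷ w))))
      vin-z : vincular z ≡ v₁ +ℕ (b +ℕ v₂)
      vin-z = ≡.trans (vincular-at-max x v v<n w<n v<w) (≡.cong (v₁ +ℕ_) (≡.cong₂ _+ℕ_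
        (≡.trans (length-map (a +ℕ_) (y ∷ w)) lenw) (vincular-map emb (y ∷ w))))
      len-z : ∀ {e₁ e₂} → length v ≡ d₁ +ℕ d₁ +ℕ e₁ → length w ≡ d₂ +ℕ d₂ +ℕ e₂ →
        length z ≡ suc (d₁ +ℕ suc d₂ +ℕ (d₁ +ℕ suc d₂) +ℕ (e₁ +ℕ e₂))
      len-z {e₁} {e₂} len₁ len₂ = ≡.cong suc (≡.trans (length-++ v)
        (≡.trans (≡.cong₂ (λ k l → k +ℕ suc (suc l)) len₁ (≡.trans (length-map (a +ℕ_) w) len₂)) (arith d₁ d₂ e₁ e₂)))
        where
        arith : ∀ d₁ d₂ e₁ e₂ → d₁ +ℕ d₁ +ℕ e₁ +ℕ suc (suc (d₂ +ℕ d₂ +ℕ e₂)) ≡ d₁ +ℕ suc d₂ +ℕ (d₁ +ℕ suc d₂) +ℕ (e₁ +ℕ e₂)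
        arith = solve-∀
      weights : (∃ λ e → length v ≡ d₁ +ℕ d₁ +ℕ e) → (∃ λ e → length w ≡ d₂ +ℕ d₂ +ℕ e) →
        weight231 z ≈ q ^ suc b * (weight231 (x ∷ v) * weight231 (y ∷ w))
      weights (e₁ , len₁) (e₂ , len₂) = begin
        weight231 z
          ≈⟨ weight231-value z des-z (len-z len₁ len₂) vin-z ⟩
        t * t ^ (d₁ +ℕ suc d₂) * q ^ (d₁ +ℕ suc d₂) * (q + t) ^ (e₁ +ℕ e₂) * q ^ (v₁ +ℕ (b +ℕ v₂))
          ≈⟨ *-cong (*-cong (*-cong (*-congˡ (^-homo-* t d₁ (suc d₂))) (^-homo-* q d₁ (suc d₂))) (^-homo-* (q + t) e₁ e₂))
               (trans (^-homo-* q v₁ (b +ℕ v₂)) (*-congˡ (^-homo-* q b v₂))) ⟩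
        t * (t ^ d₁ * (t * t ^ d₂)) * (q ^ d₁ * (q * q ^ d₂)) * ((q + t) ^ e₁ * (q + t) ^ e₂) * (q ^ v₁ * (q ^ b * q ^ v₂))
          ≈⟨ solve 11 (λ q t t₁ t₂ q₁ q₂ u₁ u₂ v₁ v₂ p →
               t :* (t₁ :* (t :* t₂)) :* (q₁ :* (q :* q₂)) :* (u₁ :* u₂) :* (v₁ :* (p :* v₂))
               := q :* p :* ((t :* t₁ :* q₁ :* u₁ :* v₁) :* (t :* t₂ :* q₂ :* u₂ :* v₂)))
               refl q t (t ^ d₁) (t ^ d₂) (q ^ d₁) (q ^ d₂) ((q + t) ^ e₁) ((q + t) ^ e₂) (q ^ v₁) (q ^ v₂) (q ^ b) ⟩
        q ^ suc b * ((t ^ suc d₁ * q ^ d₁ * (q + t) ^ e₁ * q ^ v₁) * (t ^ suc d₂ * q ^ d₂ * (q + t) ^ e₂ * q ^ v₂))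
          ≈⟨ *-congˡ (*-cong (weight231-value (x ∷ v) ≡.refl (≡.cong suc len₁) ≡.refl) (weight231-value (y ∷ w) ≡.refl (≡.cong suc len₂) ≡.refl)) ⟨
        q ^ suc b * (weight231 (x ∷ v) * weight231 (y ∷ w)) ∎

  -- The boundary value in front of `n` makes `n` a double descent as soon as a smaller letter
  -- follows.
  G-max-first : ∀ {n y} w → y < n → G (n ∷ y ∷ w) ≈ 0#
  G-max-first {n} {y} w y<n = G-zero (n ∷ y ∷ w) λ (_ , _ , dd) → contradiction
    (≡.trans (≡.sym (≡.cong (λ b → ⟦ b ⟧ +ℕ doubleDescents b (y ∷ w)) (<ᵇ-true y<n))) dd) (λ ())

  total : ℕ → Carrier
  total n = ∑ (wordsℕ n n) G

  -- The words of length a + b + 1 with maximum n at position a.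
  block : ℕ → ℕ → ℕ → Carrier
  block n a b = ∑ (wordsℕ n a) (λ v → ∑ (wordsℕ n b) (λ w → G (v ++ n ∷ w)))

  total-blocks : ∀ n → total (suc n) ≈ ∑ (antidiagonal n) (λ (a , b) → block n a b)
  total-blocks n = ∑-split-at-max n n G
    -- Without the letter `n` there would be n + 1 distinct letters below `n`.
    (λ w len w<n → G-zero w λ (u , _) → ℕ.<-irrefl ≡.refl (≡.subst (_≤ n) len (pigeonhole u w<n)))
    (λ v w n∈w → G-zero (v ++ n ∷ w) λ (u , _) → unique-twice v n∈w u)

  -- On valid words both range tests hold by `split-bounds`, and elsewhere `G` vanishes, so the
  -- tests may be inserted; they then reduce the two alphabets to a and b letters.
  block-standardise : ∀ {n} a b → a +ℕ b ≡ n →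
    block n a b ≈ ∑ (wordsℕ a a) (λ v → ∑ (wordsℕ b b) (λ w → G (v ++ n ∷ map (a +ℕ_) w)))
  block-standardise {n} a b ≡.refl = begin
    ∑ (wordsℕ n a) (λ v → ∑ (wordsℕ n b) (λ w → G (v ++ n ∷ w)))
      ≈⟨ ∑-cong-∈ (wordsℕ n a) (λ {v} v∈ → trans (∑-cong-∈ (wordsℕ n b) (λ {w} w∈ → restrict v w (∈-wordsℕ⁻ a v∈) (∈-wordsℕ⁻ b w∈)))
           (∑-*ˡ (wordsℕ n b) _ _)) ⟩
    ∑ (wordsℕ n a) (λ v → [ all? (ℕ._<? a) v ] * ∑ (wordsℕ n b) (λ w → [ all? (a ℕ.≤?_) w ] * G (v ++ n ∷ w)))
      ≈⟨ ∑-wordsℕ-embed (ℕ._<? a) n a id (∑<-below a b) a _ ⟩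
    ∑ (wordsℕ a a) (λ v → ∑ (wordsℕ n b) (λ w → [ all? (a ℕ.≤?_) w ] * G (map id v ++ n ∷ w)))
      ≈⟨ ∑-cong (wordsℕ a a) (λ v → trans
           (reflexive (≡.cong (λ v → ∑ (wordsℕ n b) (λ w → [ all? (a ℕ.≤?_) w ] * G (v ++ n ∷ w))) (map-id v)))
           (∑-wordsℕ-embed (a ℕ.≤?_) n b (a +ℕ_) (∑<-above a b) b _)) ⟩
    ∑ (wordsℕ a a) (λ v → ∑ (wordsℕ b b) (λ w → G (v ++ n ∷ map (a +ℕ_) w))) ∎
    where
    restrict : ∀ v w → length v ≡ a × All (_< n) v → length w ≡ b × All (_< n) w →
      G (v ++ n ∷ w) ≈ [ all? (ℕ._<? a) v ] * ([ all? (a ℕ.≤?_) w ] * G (v ++ n ∷ w))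
    restrict v w (lenv , v<n) (lenw , w<n) = trans ([]-cong (valid231? (v ++ n ∷ w)) inside)
      (solve 4 (λ i j k x → i :* (j :* (k :* x)) := j :* (k :* (i :* x))) refl _ _ _ _)
      where
      inside : Valid231 (v ++ n ∷ w) →
        weight231 (v ++ n ∷ w) ≈ [ all? (ℕ._<? a) v ] * ([ all? (a ℕ.≤?_) w ] * weight231 (v ++ n ∷ w))
      inside (u , ts , _) with split-at-max v v<n u ts
      ... | (uv , uw) , _ , v<w with split-bounds lenv lenw v<n w<n uv uw v<w
      ...   | v<a , a≤w = sym (trans (*-cong ([]-true (all? (ℕ._<? a) v) v<a) (*-congʳ ([]-true (all? (a ℕ.≤?_) w) a≤w)))
                (trans (*-identityˡ _) (*-identityˡ _)))

  block-first : ∀ n → block (suc n) 0 (suc n) ≈ 0#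
  block-first n =
    trans (+-identityʳ _) (trans (∑-cong-∈ (wordsℕ (suc n) (suc n)) λ {w} w∈ → first w (∈-wordsℕ⁻ (suc n) w∈)) (∑-zero (wordsℕ (suc n) (suc n))))
    where
    first : ∀ w → length w ≡ suc n × All (_< suc n) w → G (suc n ∷ w) ≈ 0#
    first (y ∷ w) (_ , y<n ∷ _) = G-max-first w y<n

  block-last : ∀ n → block (suc n) (suc n) 0 ≈ (q + t) * total (suc n)
  block-last n = begin
    block (suc n) (suc n) 0
      ≈⟨ block-standardise (suc n) 0 (ℕ.+-identityʳ (suc n)) ⟩
    ∑ (wordsℕ (suc n) (suc n)) (λ v → G (v ++ suc n ∷ []) + 0#)
      ≈⟨ ∑-cong-∈ (wordsℕ (suc n) (suc n)) (λ {v} v∈ → trans (+-identityʳ _) (last v (∈-wordsℕ⁻ (suc n) v∈))) ⟩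
    ∑ (wordsℕ (suc n) (suc n)) (λ v → (q + t) * G v)
      ≈⟨ ∑-*ˡ (wordsℕ (suc n) (suc n)) _ _ ⟩
    (q + t) * total (suc n) ∎
    where
    last : ∀ v → length v ≡ suc n × All (_< suc n) v → G (v ++ suc n ∷ []) ≈ (q + t) * G v
    last (x ∷ v) (_ , v<n) = ≡.subst (λ m → G (x ∷ v ++ m ∷ []) ≈ (q + t) * G (x ∷ v)) (ℕ.+-identityʳ (suc n))
      (G-max-last {b = 0} v<n ≡.refl)

  block-inner : ∀ {n} a b → suc a +ℕ suc b ≡ n → block n (suc a) (suc b) ≈ q ^ suc (suc b) * (total (suc a) * total (suc b))
  block-inner a b ≡.refl = begin
    block n (suc a) (suc b)
      ≈⟨ block-standardise (suc a) (suc b) ≡.refl ⟩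
    ∑ V (λ v → ∑ W (λ w → G (v ++ n ∷ map (suc a +ℕ_) w)))
      ≈⟨ ∑-cong-∈ V (λ {v} v∈ → ∑-cong-∈ W (λ {w} w∈ → inner v w (∈-wordsℕ⁻ (suc a) v∈) (∈-wordsℕ⁻ (suc b) w∈))) ⟩
    ∑ V (λ v → ∑ W (λ w → q ^ suc (suc b) * (G v * G w)))
      ≈⟨ ∑-cong V (λ v → trans (∑-*ˡ W _ _) (*-congˡ (∑-*ˡ W _ _))) ⟩
    ∑ V (λ v → q ^ suc (suc b) * (G v * total (suc b)))
      ≈⟨ trans (∑-*ˡ V _ _) (*-congˡ (∑-*ʳ V _ _)) ⟩
    q ^ suc (suc b) * (total (suc a) * total (suc b)) ∎
    where
    n = suc a +ℕ suc b
    V = wordsℕ (suc a) (suc a)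
    W = wordsℕ (suc b) (suc b)
    inner : ∀ v w → length v ≡ suc a × All (_< suc a) v → length w ≡ suc b × All (_< suc b) w →
      G (v ++ n ∷ map (suc a +ℕ_) w) ≈ q ^ suc (suc b) * (G v * G w)
    inner (x ∷ v) (y ∷ w) (_ , v<a) (lenw , w<b) = G-max-inner v<a lenw w<b

  total-one : total 1 ≈ t
  total-one = trans (+-identityʳ _) (trans (*-congʳ ([]-true (valid231? (0 ∷ [])) ([] ∷ [] , ([] , tt) , ≡.refl)))
    (solve 1 (λ t → con 1 :* (t :* con 1 :* con 1 :* con 1 :* con 1) := t) refl t))

  total-two : total 2 ≈ (q + t) * total 1
  total-two = begin
    total 2                                ≈⟨ total-blocks 1 ⟩
    block 1 0 1 + (block 1 1 0 + 0#)       ≈⟨ +-cong (block-first 0) (trans (+-identityʳ _) (block-last 0)) ⟩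
    0# + (q + t) * total 1                 ≈⟨ +-identityˡ _ ⟩
    (q + t) * total 1                      ∎

  total-convolution : ∀ n → total (suc (suc (suc n))) ≈
    (q + t) * total (suc (suc n)) + ∑ (antidiagonal n) (λ (a , b) → q ^ suc (suc b) * (total (suc a) * total (suc b)))
  total-convolution n = begin
    total (suc N)
      ≈⟨ total-blocks N ⟩
    ∑ (antidiagonal N) (λ (a , b) → block N a b)
      ≈⟨ ∑-antidiagonal-suc (suc n) _ ⟩
    block N 0 N + ∑ (antidiagonal (suc n)) (λ (a , b) → block N (suc a) b)
      ≈⟨ +-cong (block-first (suc n)) (∑-antidiagonal-last n _) ⟩
    0# + (block N N 0 + ∑ (antidiagonal n) (λ (a , b) → block N (suc a) (suc b)))
      ≈⟨ +-identityˡ _ ⟩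
    block N N 0 + ∑ (antidiagonal n) (λ (a , b) → block N (suc a) (suc b))
      ≈⟨ +-cong (block-last (suc n)) (∑-cong-∈ (antidiagonal n) (λ {(a , b)} p →
           block-inner a b (≡.cong suc (≡.trans (ℕ.+-suc a b) (≡.cong suc (antidiagonal-sum n p)))))) ⟩
    (q + t) * total N + ∑ (antidiagonal n) (λ (a , b) → q ^ suc (suc b) * (total (suc a) * total (suc b))) ∎
    where N = suc (suc n)

-- 321-avoiding words

-- The letters below h are those smaller than the record of a prefix preceding the word.
lrMaxima : ℕ → List ℕ → ℕ
lrMaxima h []      = 0
lrMaxima h (x ∷ w) = if h <ᵇ suc x then suc (lrMaxima (suc x) w) else lrMaxima h w

wexFrom : ℕ → List ℕ → ℕ
wexFrom i []      = 0
wexFrom i (x ∷ w) = ⟦ i <ᵇ suc x ⟧ +ℕ wexFrom (suc i) w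

-- The continuations of a 321-avoiding prefix, with h as for lrMaxima.
Valid321 : ℕ → List ℕ → Set
Valid321 h w = Unique w × AllPairs (No321 h) w × AllTriples No321 w

valid321? : ∀ h w → Dec (Valid321 h w)
valid321? h w = unique? w ×-dec (AllPairs.allPairs? (no321? h) w ×-dec allTriples? {No321} no321? w)

-- A letter x after a larger one y is followed only by letters above x, and y, x and these letters are
-- too many for the interval [x, n) unless x is below its position.
nonrecord-not-wex : ∀ {n h x} v w → h ≡ 0 ⊎ (∃ λ y → y ∈ v × h ≡ suc y) → x < h → All (No321 h x) w →
  All (_< n) v → All (_< n) (x ∷ w) → All (λ z → All (_≢ z) v) (x ∷ w) → Unique (x ∷ w) →
  length v +ℕ suc (length w) ≡ n → ¬ (length v < suc x)
nonrecord-not-wex v w (inj₁ ≡.refl) ()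
nonrecord-not-wex {n} {h} {x} v w (inj₂ (y , y∈v , ≡.refl)) x<h below v<n (x<n ∷ w<n) (x∉v ∷ w∉v) u len (s≤s v≤x) =
  ℕ.<-irrefl ≡.refl (begin-strict
    n                                   ≡⟨ len ⟨
    length v +ℕ suc (length w)          ≤⟨ ℕ.+-monoˡ-≤ (suc (length w)) v≤x ⟩
    x +ℕ suc (length w)                 <⟨ ℕ.+-monoʳ-< x (ℕ.n<1+n _) ⟩
    x +ℕ suc (suc (length w))           ≤⟨ pigeonhole-interval {w = y ∷ x ∷ w}
      ((y≢x ∷ All.map (λ ps → All.lookup ps y∈v) w∉v) ∷ u)
      (ℕ.<⇒≤ x<y ∷ ℕ.≤-refl ∷ All.map (λ avoid → ℕ.≮⇒≥ (λ z<x → avoid (z<x , x<h))) below)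
      (All.lookup v<n y∈v ∷ x<n ∷ w<n) (ℕ.<⇒≤ x<n) ⟩
    n                                   ∎)
  where
  open ℕ.≤-Reasoning
  y≢x = All.lookup x∉v y∈v
  x<y = ℕ.≤∧≢⇒< (ℕ.≤-pred x<h) (y≢x ∘ ≡.sym)

-- Here v is the prefix already read, in reverse.
wexFrom≡lrMaxima : ∀ {n h} v w → Unique v → All (_< h) v → h ≡ 0 ⊎ (∃ λ y → y ∈ v × h ≡ suc y) →
  All (_< n) v → All (_< n) w → All (λ z → All (_≢ z) v) w → length v +ℕ length w ≡ n →
  Valid321 h w → wexFrom (length v) w ≡ lrMaxima h w
wexFrom≡lrMaxima v [] uv v<h h∈ v<n w<n w∉v len valid = ≡.refl
wexFrom≡lrMaxima {n} {h} v (x ∷ w) uv v<h h∈ v<n (x<n ∷ w<n) (x∉v ∷ w∉v) len (x∉w ∷ uw , (below ∷ inc) , (inc′ , av))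
  with h ℕ.<? suc x
-- A record is a weak excedance: the letters before it are distinct and below `x`, so there are at
-- most `x` of them.
... | yes h≤x rewrite <ᵇ-true h≤x | <ᵇ-true {length v} {suc x} (s≤s (pigeonhole uv (All.map (λ y<h → ℕ.<-≤-trans y<h (ℕ.≤-pred h≤x)) v<h))) =
  ≡.cong suc (wexFrom≡lrMaxima (x ∷ v) w
    (All.map (λ y≢x x≡y → y≢x (≡.sym x≡y)) x∉v ∷ uv)
    (ℕ.≤-refl ∷ All.map (λ y<h → ℕ.<-≤-trans y<h (ℕ.m≤n⇒m≤1+n (ℕ.≤-pred h≤x))) v<h)
    (inj₂ (x , here ≡.refl , ≡.refl)) (x<n ∷ v<n) w<n (All.zipWith (λ (p , ps) → p ∷ ps) (x∉w , w∉v))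
    (≡.trans (≡.sym (ℕ.+-suc (length v) (length w))) len)
    -- Letters keep their names here, so the record `x` yields the threshold `suc x`; the value `x`
    -- itself is excluded by distinctness.
    (uw , AllPairs.map (λ (avoid , x≢y) (z<y , y≤x) → avoid (z<y , ℕ.≤∧≢⇒< (ℕ.≤-pred y≤x) (x≢y ∘ ≡.sym))) incs , av))
    where
    pairs : ∀ {w} → All (x ≢_) w → AllPairs (λ y z → x ≢ y) w
    pairs []         = []
    pairs (x≢y ∷ ps) = All.universal (λ _ → x≢y) _ ∷ pairs ps
    incs = AllPairs.zip (inc′ , pairs x∉w)
... | no h≰x rewrite <ᵇ-false h≰x | <ᵇ-false
    (nonrecord-not-wex v w h∈ (ℕ.≰⇒> (h≰x ∘ s≤s)) below v<n (x<n ∷ w<n) (x∉v ∷ w∉v) (x∉w ∷ uw) len) =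
  wexFrom≡lrMaxima (x ∷ v) w
    (All.map (λ y≢x x≡y → y≢x (≡.sym x≡y)) x∉v ∷ uv)
    (ℕ.≰⇒> (h≰x ∘ s≤s) ∷ v<h) (later h∈) (x<n ∷ v<n) w<n (All.zipWith (λ (p , ps) → p ∷ ps) (x∉w , w∉v))
    (≡.trans (≡.sym (ℕ.+-suc (length v) (length w))) len)
    (uw , inc , av)
    where
    later : h ≡ 0 ⊎ (∃ λ y → y ∈ v × h ≡ suc y) → h ≡ 0 ⊎ (∃ λ y → y ∈ x ∷ v × h ≡ suc y)
    later (inj₁ eq)             = inj₁ eq
    later (inj₂ (y , y∈v , eq)) = inj₂ (y , there y∈v , eq)

-- Deleting the first letter and relabelling the rest

punchIn-embedding : ∀ x → OrderEmbedding (punchIn x)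
punchIn-embedding zero    y       z       = ≡.refl
punchIn-embedding (suc x) zero    zero    = ≡.refl
punchIn-embedding (suc x) zero    (suc z) = ≡.refl
punchIn-embedding (suc x) (suc y) zero    = ≡.refl
punchIn-embedding (suc x) (suc y) (suc z) = punchIn-embedding x y z

punchIn-≢ : ∀ x y → x ≢ punchIn x y
punchIn-≢ (suc x) (suc y) eq = punchIn-≢ x y (ℕ.suc-injective eq)

punchIn-<ᵇ : ∀ x y → (punchIn x y <ᵇ x) ≡ (y <ᵇ x)
punchIn-<ᵇ zero    y       = ≡.refl
punchIn-<ᵇ (suc x) zero    = ≡.refl
punchIn-<ᵇ (suc x) (suc y) = punchIn-<ᵇ x y

punchIn-≥ : ∀ {x y} → x ≤ y → punchIn x y ≡ suc y
punchIn-≥ z≤n       = ≡.refl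
punchIn-≥ (s≤s x≤y) = ≡.cong suc (punchIn-≥ x≤y)

punchIn-≤ : ∀ x y → punchIn x y ≤ suc y
punchIn-≤ zero    y       = ℕ.≤-refl
punchIn-≤ (suc x) zero    = z≤n
punchIn-≤ (suc x) (suc y) = s≤s (punchIn-≤ x y)

punchIn-<⁺ : ∀ {x y} → y < x → punchIn x y < x
punchIn-<⁺ {suc x} {zero}  y<x       = s≤s z≤n
punchIn-<⁺ {suc x} {suc y} (s≤s y<x) = s≤s (punchIn-<⁺ y<x)

punchIn-<⁻ : ∀ {x y} → punchIn x y < x → y < x
punchIn-<⁻ {suc x} {zero}  _       = s≤s z≤n
punchIn-<⁻ {suc x} {suc y} (s≤s p) = s≤s (punchIn-<⁻ p)

-- Reinserting a letter x ≤ m raises the letters from x on together with the threshold; the letters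
-- below x stay below it. The cases used are x = m for a record and x = 0 for the smallest letter.
lrMaxima-punchIn : ∀ {x m} w → x ≤ m → lrMaxima (suc m) (map (punchIn x) w) ≡ lrMaxima m w
lrMaxima-punchIn []      x≤m = ≡.refl
lrMaxima-punchIn {x} {m} (y ∷ w) x≤m with m ℕ.<? suc y
... | yes m≤y rewrite punchIn-≥ (ℕ.≤-trans x≤m (ℕ.≤-pred m≤y)) | <ᵇ-true m≤y =
  ≡.cong suc (lrMaxima-punchIn w (ℕ.≤-trans x≤m (ℕ.m≤n⇒m≤1+n (ℕ.≤-pred m≤y))))
... | no m≰y rewrite <ᵇ-false m≰y | <ᵇ-false {m} {punchIn x y} (λ m<p → m≰y (ℕ.<-≤-trans m<p (punchIn-≤ x y))) =
  lrMaxima-punchIn w x≤m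

tally-filter : ∀ x w → tally (_<ᵇ x) w ≡ length (filter (ℕ._<? x) w)
tally-filter x []      = ≡.refl
tally-filter x (y ∷ w) with y <ᵇ x
... | true  = ≡.cong suc (tally-filter x w)
... | false = tally-filter x w

length-filters : ∀ x w → length w ≡ length (filter (ℕ._<? x) w) +ℕ length (filter (¬? ∘ (ℕ._<? x)) w)
length-filters x []      = ≡.refl
length-filters x (y ∷ w) with y <ᵇ x
... | true  = ≡.cong suc (length-filters x w)
... | false = ≡.trans (≡.cong suc (length-filters x w)) (≡.sym (ℕ.+-suc _ _))

-- At most x letters lie below x and at most r - x lie in [x, r); since there are r letters, both
-- bounds are attained.
tally-smaller : ∀ {r w x} → Unique w → length w ≡ r → All (_< r) w → x ≤ r → tally (_<ᵇ x) w ≡ x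
tally-smaller {r} {w} {x} u len w<r x≤r = ≡.trans (tally-filter x w) (ℕ.≤-antisym
  (pigeonhole (Unique.filter⁺ (ℕ._<? x) u) (All.all-filter (ℕ._<? x) w))
  (ℕ.+-cancelʳ-≤ (length large) _ _ (begin
    x +ℕ length large                             ≤⟨ pigeonhole-interval (Unique.filter⁺ (¬? ∘ (ℕ._<? x)) u)
      (All.map ℕ.≮⇒≥ (All.all-filter (¬? ∘ (ℕ._<? x)) w)) (All.filter⁺ (¬? ∘ (ℕ._<? x)) w<r) x≤r ⟩
    r                                             ≡⟨ len ⟨
    length w                                      ≡⟨ length-filters x w ⟩
    length (filter (ℕ._<? x) w) +ℕ length large   ∎)))
  where
  open ℕ.≤-Reasoning
  large = filter (¬? ∘ (ℕ._<? x)) w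

allPairs-⇔ : ∀ {R S : ℕ → ℕ → Set} {e : ℕ → ℕ} → (∀ y z → R (e y) (e z) ⇔ S y z) →
  ∀ {w} → AllPairs R (map e w) ⇔ AllPairs S w
allPairs-⇔ R⇔S = mk⇔
  (AllPairs.map (λ {y} {z} → Equivalence.to (R⇔S y z)) ∘ AllPairs.map⁻)
  (AllPairs.map⁺ ∘ AllPairs.map (λ {y} {z} → Equivalence.from (R⇔S y z)))

module _ {x : ℕ} {w : List ℕ} where
  private
    emb : OrderEmbedding (punchIn x)
    emb = punchIn-embedding x
    triples⇔ = allTriples-map {e = punchIn x} emb (no321-map {e = punchIn x} emb) w
    x∉ : All (x ≢_) (map (punchIn x) w)
    x∉ = All.map⁺ (All.universal (punchIn-≢ x) w)

  -- After deletion of the new record `x`, the letters below it are 0, ..., x - 1, so `x` is also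
  -- the new threshold. Its condition implies the one for the old threshold h ≤ x.
  valid321-record : ∀ {h} → h ≤ x → Valid321 h (x ∷ map (punchIn x) w) ⇔ Valid321 x w
  valid321-record {h} h≤x = mk⇔
    (λ (u , _ , (inc , av)) → Unique.map⁻ (AllPairs.tail u) , Equivalence.to inc⇔ inc , Equivalence.from triples⇔ av)
    (λ (u , inc , av) →
      x∉ ∷ Unique.map⁺ (embedding-injective emb) u ,
      (All.universal (λ z (_ , x<h) → ℕ.<⇒≱ x<h h≤x) _ ∷
        AllPairs.map (λ avoid (z<y , y<h) → avoid (z<y , ℕ.<-≤-trans y<h h≤x)) (Equivalence.from inc⇔ inc)) ,
      (Equivalence.from inc⇔ inc , Equivalence.to triples⇔ av))
    where
    inc⇔ : AllPairs (No321 x) (map (punchIn x) w) ⇔ AllPairs (No321 x) w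
    inc⇔ = allPairs-⇔ (λ y z → mk⇔ (λ avoid (z<y , y<x) → avoid (<-preserved emb z<y , punchIn-<⁺ y<x))
                                   (λ avoid (z<y , y<x) → avoid (<-reflected emb z<y , punchIn-<⁻ y<x)))

-- With nothing below it, 0 can be neither the 3 nor the 2 of a pattern 321; its removal leaves one
-- letter fewer below the record.
valid321-zero : ∀ {h w} → Valid321 (suc h) (0 ∷ map suc w) ⇔ Valid321 h w
valid321-zero {h} {w} = mk⇔
  (λ (u , inc , (_ , av)) → Unique.map⁻ (AllPairs.tail u) , Equivalence.to inc⇔ (AllPairs.tail inc) , Equivalence.from triples⇔ av)
  (λ (u , inc , av) →
    All.map⁺ (All.universal (λ _ ()) w) ∷ Unique.map⁺ ℕ.suc-injective u ,
    (All.universal (λ z ()) _ ∷ Equivalence.from inc⇔ inc) ,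
    (AllPairs.map (λ _ ()) (Equivalence.from inc⇔ inc) , Equivalence.to triples⇔ av))
  where
  triples⇔ = allTriples-map (punchIn-embedding 0) (no321-map (punchIn-embedding 0)) w
  inc⇔ : AllPairs (No321 (suc h)) (map suc w) ⇔ AllPairs (No321 h) w
  inc⇔ = allPairs-⇔ (λ y z → mk⇔ (λ avoid (z<y , y<h) → avoid (s≤s z<y , s≤s y<h))
                                 (λ avoid (z<y , y<h) → avoid (ℕ.≤-pred z<y , ℕ.≤-pred y<h)))

-- A letter below the record must be the smallest remaining one.
valid321-small : ∀ {r h x w} → length w ≡ r → All (_< r) w → suc x ≤ r → suc x < h → ¬ Valid321 h (suc x ∷ map (punchIn (suc x)) w)
valid321-small {r} {h} {x} {w} len w<r x<r x<h (_ ∷ u , (below ∷ _) , _) =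
  ℕ.1+n≰n (ℕ.≤-trans (s≤s (ℕ.m≤n+m r x)) (≡.subst (λ l → suc x +ℕ l ≤ r) len
    (pigeonhole-interval (Unique.map⁻ u)
      (All.map (λ avoid → ℕ.≮⇒≥ (λ y<x → avoid (punchIn-<⁺ y<x , x<h))) (All.map⁻ below)) w<r x<r)))

module Patterns321 {c ℓ} (R : CommutativeRing c ℓ) (t q : CommutativeRing.Carrier R) where
  open CommutativeRing R hiding (zero)
  open SumsAndPowers R
  open Sums R
  open Paths R t q
  open import Relation.Binary.Reasoning.Setoid setoid
  open import Algebra.Properties.Semiring.Exp semiring using (^-homo-*; ^-congʳ)
  open import Algebra.Solver.Ring.NaturalCoefficients.Default commutativeSemiring using (solve; _:=_; _:*_; con)

  weight321 : ℕ → List ℕ → Carrier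
  weight321 h w = t ^ lrMaxima h w * q ^ inversions w

  W : ℕ → List ℕ → Carrier
  W h w = [ valid321? h w ] * weight321 h w

  W-record : ∀ {r h x} w → length w ≡ r → All (_< r) w → x ≤ r → h ≤ x →
    W h (x ∷ map (punchIn x) w) ≈ t * q ^ x * W x w
  W-record {r} {h} {x} w len w<r x≤r h≤x = begin
    [ valid321? h z ] * weight321 h z
      ≈⟨ *-congʳ ([]-⇔ (valid321-record h≤x) (valid321? h z) (valid321? x w)) ⟩
    [ valid321? x w ] * weight321 h z
      ≈⟨ []-cong (valid321? x w) (λ (u , _) → trans
           (*-cong (^-congʳ t lr) (trans (^-congʳ q (inversions-z u)) (^-homo-* q x (inversions w))))
           (solve 4 (λ t p a b → t :* a :* (p :* b) := t :* p :* (a :* b)) refl t (q ^ x) _ _)) ⟩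
    [ valid321? x w ] * (t * q ^ x * weight321 x w)
      ≈⟨ solve 3 (λ i p w → i :* (p :* w) := p :* (i :* w)) refl _ _ _ ⟩
    t * q ^ x * W x w ∎
    where
    z = x ∷ map (punchIn x) w
    lr : lrMaxima h z ≡ suc (lrMaxima x w)
    lr rewrite <ᵇ-true (s≤s h≤x) = ≡.cong suc (lrMaxima-punchIn w ℕ.≤-refl)
    inversions-z : Unique w → inversions z ≡ x +ℕ inversions w
    inversions-z u = ≡.cong₂ _+ℕ_
      (≡.trans (tally-map _ (punchIn x) w) (≡.trans (tally-cong (All.universal (punchIn-<ᵇ x) w)) (tally-smaller u len w<r x≤r)))
      (inversions-map (punchIn-embedding x) w)

  W-zero : ∀ h w → W (suc h) (0 ∷ map suc w) ≈ W h w
  W-zero h w = *-cong ([]-⇔ valid321-zero (valid321? (suc h) (0 ∷ map suc w)) (valid321? h w))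
    (*-cong (^-congʳ t (lrMaxima-punchIn w z≤n))
      (^-congʳ q (≡.cong₂ _+ℕ_ (tally-none (All.universal (λ _ → ≡.refl) (map suc w))) (inversions-map (punchIn-embedding 0) w))))

  ∑-W-first : ∀ r h x → x ≤ r →
    ∑ (wordsℕ (suc r) r) (W h ∘ (x ∷_)) ≈ ∑ (wordsℕ r r) (λ w → W h (x ∷ map (punchIn x) w))
  ∑-W-first r h x x≤r = begin
    ∑ (wordsℕ (suc r) r) (W h ∘ (x ∷_))
      ≈⟨ ∑-cong (wordsℕ (suc r) r) (λ w → trans ([]-cong (valid321? h (x ∷ w)) (λ (u , _) →
           sym (trans (*-congʳ ([]-true (all? (λ y → ¬? (x ℕ.≟ y)) w) (AllPairs.head u))) (*-identityˡ _))))
           (solve 3 (λ i j x → i :* (j :* x) := j :* (i :* x)) refl _ _ _)) ⟩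
    ∑ (wordsℕ (suc r) r) (λ w → [ all? (λ y → ¬? (x ℕ.≟ y)) w ] * W h (x ∷ w))
      ≈⟨ ∑-wordsℕ-embed (λ y → ¬? (x ℕ.≟ y)) (suc r) r (punchIn x) (λ f → ∑<-punchIn x r f x≤r) r _ ⟩
    ∑ (wordsℕ r r) (λ w → W h (x ∷ map (punchIn x) w)) ∎

  -- Words are classified by their first letter: a record, the letter 0 below the record, or a
  -- positive letter below the record, which contributes nothing. Deleting it standardises the rest
  -- to r - 1 letters.
  ∑-W : ∀ r h → h ≤ r → ∑ (wordsℕ r r) (W h) ≈ F r h

  ∑-W-record : ∀ r h x → x ≤ r → h ≤ x → ∑ (wordsℕ (suc r) r) (W h ∘ (x ∷_)) ≈ t * q ^ x * F r x
  ∑-W-record r h x x≤r h≤x = begin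
    ∑ (wordsℕ (suc r) r) (W h ∘ (x ∷_))
      ≈⟨ ∑-W-first r h x x≤r ⟩
    ∑ (wordsℕ r r) (λ w → W h (x ∷ map (punchIn x) w))
      ≈⟨ ∑-cong-∈ (wordsℕ r r) (λ {w} w∈ → W-record w (proj₁ (∈-wordsℕ⁻ r w∈)) (proj₂ (∈-wordsℕ⁻ r w∈)) x≤r h≤x) ⟩
    ∑ (wordsℕ r r) (λ w → t * q ^ x * W x w)
      ≈⟨ ∑-*ˡ (wordsℕ r r) _ _ ⟩
    t * q ^ x * ∑ (wordsℕ r r) (W x)
      ≈⟨ *-congˡ (∑-W r x x≤r) ⟩
    t * q ^ x * F r x ∎

  ∑-W-small : ∀ r h x → suc x ≤ r → suc x < h → ∑ (wordsℕ (suc r) r) (W h ∘ (suc x ∷_)) ≈ 0#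
  ∑-W-small r h x x<r x<h = trans (∑-W-first r h (suc x) x<r) (trans
    (∑-cong-∈ (wordsℕ r r) (λ {w} w∈ → trans
      (*-congʳ ([]-false (valid321? h _) (valid321-small (proj₁ (∈-wordsℕ⁻ r w∈)) (proj₂ (∈-wordsℕ⁻ r w∈)) x<r x<h)))
      (zeroˡ _)))
    (∑-zero (wordsℕ r r)))

  ∑-W zero h h≤r = trans (+-identityʳ _) (trans (*-congʳ ([]-true (valid321? h []) ([] , [] , tt)))
    (solve 0 (con 1 :* (con 1 :* con 1) := con 1) refl))
  ∑-W (suc r) zero _ = begin
    ∑ (wordsℕ (suc r) (suc r)) (W 0)
      ≈⟨ ∑-wordsℕ-suc (suc r) r (W 0) ⟩
    ∑ (upTo (suc r)) (λ x → ∑ (wordsℕ (suc r) r) (W 0 ∘ (x ∷_)))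
      ≈⟨ ∑-cong-∈ (upTo (suc r)) (λ {x} x∈ → trans (∑-W-record r 0 x (ℕ.≤-pred (∈-upTo⁻ x∈)) z≤n) (sym (*-identityˡ _))) ⟩
    ∑ (upTo (suc r)) (λ x → 1# * (t * q ^ x * F r x))
      ≈⟨ +-identityˡ _ ⟨
    F (suc r) 0 ∎
  ∑-W (suc r) (suc h) (s≤s h≤r) = begin
    ∑ (wordsℕ (suc r) (suc r)) (W (suc h))
      ≈⟨ ∑-wordsℕ-suc (suc r) r (W (suc h)) ⟩
    ∑ (upTo (suc r)) (λ x → ∑ (wordsℕ (suc r) r) (W (suc h) ∘ (x ∷_)))
      ≈⟨ ∑<-suc r _ ⟩
    ∑ (wordsℕ (suc r) r) (W (suc h) ∘ (0 ∷_)) + ∑ (upTo r) (λ x → ∑ (wordsℕ (suc r) r) (W (suc h) ∘ (suc x ∷_)))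
      ≈⟨ +-cong
           (trans (∑-W-first r (suc h) 0 z≤n) (trans (∑-cong (wordsℕ r r) (W-zero h)) (∑-W r h h≤r)))
           (∑-cong-∈ (upTo r) (λ {x} x∈ → first x (∈-upTo⁻ x∈))) ⟩
    F r h + ∑ (upTo r) (λ x → [ suc h ℕ.<? suc (suc x) ] * (t * q ^ suc x * F r (suc x)))
      -- The summand x = 0 of `F` carries the false test `suc h < 1` and can be put back.
      ≈⟨ +-congˡ (trans (∑<-suc r _) (trans (+-congʳ (zeroˡ _)) (+-identityˡ _))) ⟨
    F r h + ∑ (upTo (suc r)) (λ x → [ suc h ℕ.<? suc x ] * (t * q ^ x * F r x)) ∎
    where
    first : ∀ x → suc x ≤ r →
      ∑ (wordsℕ (suc r) r) (W (suc h) ∘ (suc x ∷_)) ≈ [ suc h ℕ.<? suc (suc x) ] * (t * q ^ suc x * F r (suc x))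
    first x x<r with suc h ℕ.≤? suc x
    ... | yes h≤x = trans (∑-W-record r (suc h) (suc x) x<r h≤x)
                      (sym (trans (*-congʳ ([]-true (suc h ℕ.<? suc (suc x)) (s≤s h≤x))) (*-identityˡ _)))
    ... | no h≰x  = trans (∑-W-small r (suc h) x x<r (ℕ.≰⇒> h≰x))
                      (sym (trans (*-congʳ ([]-false (suc h ℕ.<? suc (suc x)) (h≰x ∘ ℕ.≤-pred))) (zeroˡ _)))

-- Permutations as words of natural numbers

-- Letters become 0-based, whereas `letter` and `_⟨_⟩` are 1-based.
encode : ∀ {m l} → Vec (Fin m) l → List ℕ
encode []      = []
encode (x ∷ w) = toℕ x ∷ encode w

length-encode : ∀ {m l} (w : Vec (Fin m) l) → length (encode w) ≡ l
length-encode []      = ≡.refl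
length-encode (x ∷ w) = ≡.cong suc (length-encode w)

encode-< : ∀ {m l} (w : Vec (Fin m) l) → All (_< m) (encode w)
encode-< []      = []
encode-< (x ∷ w) = toℕ<n x ∷ encode-< w

All-encode : ∀ {m l} {P : ℕ → Set} (w : Vec (Fin m) l) → All P (encode w) ⇔ (∀ i → P (toℕ (lookup w i)))
All-encode {m} {P = P} w = mk⇔ (to w) (from w)
  where
  to : ∀ {l} (w : Vec (Fin m) l) → All P (encode w) → ∀ i → P (toℕ (lookup w i))
  to (x ∷ w) (p ∷ ps) fzero    = p
  to (x ∷ w) (p ∷ ps) (fsuc i) = to w ps i
  from : ∀ {l} (w : Vec (Fin m) l) → (∀ i → P (toℕ (lookup w i))) → All P (encode w)
  from []      f = []
  from (x ∷ w) f = f fzero ∷ from w (f ∘ fsuc)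

AllPairs-encode : ∀ {m l} {S : ℕ → ℕ → Set} (w : Vec (Fin m) l) →
  AllPairs S (encode w) ⇔ (∀ i j → i <ᶠ j → S (toℕ (lookup w i)) (toℕ (lookup w j)))
AllPairs-encode {m} {S = S} w = mk⇔ (to w) (from w)
  where
  to : ∀ {l} (w : Vec (Fin m) l) → AllPairs S (encode w) → ∀ i j → i <ᶠ j → S (toℕ (lookup w i)) (toℕ (lookup w j))
  to (x ∷ w) (p ∷ ps) fzero    (fsuc j) _         = Equivalence.to (All-encode w) p j
  to (x ∷ w) (p ∷ ps) (fsuc i) (fsuc j) (s≤s i<j) = to w ps i j i<j
  from : ∀ {l} (w : Vec (Fin m) l) → (∀ i j → i <ᶠ j → S (toℕ (lookup w i)) (toℕ (lookup w j))) → AllPairs S (encode w)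
  from []      f = []
  from (x ∷ w) f = Equivalence.from (All-encode w) (λ j → f fzero (fsuc j) (s≤s z≤n)) ∷ from w (λ i j i<j → f (fsuc i) (fsuc j) (s≤s i<j))

AllTriples-encode : ∀ {m l} {R : ℕ → ℕ → ℕ → Set} (w : Vec (Fin m) l) →
  AllTriples R (encode w) ⇔
  (∀ i j k → i <ᶠ j → j <ᶠ k → R (toℕ (lookup w i)) (toℕ (lookup w j)) (toℕ (lookup w k)))
AllTriples-encode {m} {R = R} w = mk⇔ (to w) (from w)
  where
  to : ∀ {l} (w : Vec (Fin m) l) → AllTriples R (encode w) →
    ∀ i j k → i <ᶠ j → j <ᶠ k → R (toℕ (lookup w i)) (toℕ (lookup w j)) (toℕ (lookup w k))
  to (x ∷ w) (p , ps) fzero    (fsuc j) (fsuc k) _         (s≤s j<k) = Equivalence.to (AllPairs-encode w) p j k j<k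
  to (x ∷ w) (p , ps) (fsuc i) (fsuc j) (fsuc k) (s≤s i<j) (s≤s j<k) = to w ps i j k i<j j<k
  from : ∀ {l} (w : Vec (Fin m) l) →
    (∀ i j k → i <ᶠ j → j <ᶠ k → R (toℕ (lookup w i)) (toℕ (lookup w j)) (toℕ (lookup w k))) → AllTriples R (encode w)
  from []      f = tt
  from (x ∷ w) f =
    Equivalence.from (AllPairs-encode w) (λ j k j<k → f fzero (fsuc j) (fsuc k) (s≤s z≤n) (s≤s j<k)) ,
    from w (λ i j k i<j j<k → f (fsuc i) (fsuc j) (fsuc k) (s≤s i<j) (s≤s j<k))

unique-encode : ∀ {m l} (w : Vec (Fin m) l) → AllPairsV _≢_ w ⇔ Unique (encode w)
unique-encode w = mk⇔ (to w) (from w)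
  where
  toAll : ∀ {m l} {x : Fin m} (w : Vec (Fin m) l) → AllV (x ≢_) w → All (toℕ x ≢_) (encode w)
  toAll []      []       = []
  toAll (y ∷ w) (p ∷ ps) = (p ∘ toℕ-injective) ∷ toAll w ps
  fromAll : ∀ {m l} {x : Fin m} (w : Vec (Fin m) l) → All (toℕ x ≢_) (encode w) → AllV (x ≢_) w
  fromAll []      []       = []
  fromAll (y ∷ w) (p ∷ ps) = (p ∘ ≡.cong toℕ) ∷ fromAll w ps
  to : ∀ {m l} (w : Vec (Fin m) l) → AllPairsV _≢_ w → Unique (encode w)
  to []      []       = []
  to (x ∷ w) (p ∷ ps) = toAll w p ∷ to w ps
  from : ∀ {m l} (w : Vec (Fin m) l) → Unique (encode w) → AllPairsV _≢_ w
  from []      []       = []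
  from (x ∷ w) (p ∷ ps) = fromAll w p ∷ from w ps

-- It suffices that π preserves the order of τ: the converse follows since τ has distinct letters.
occurrence : ∀ {n} (τ : Vec (Fin 3) 3) (π : Vec (Fin n) n) {i j k} → i <ᶠ j → j <ᶠ k →
  (∀ a b → lookup τ a ≡ lookup τ b → a ≡ b) →
  (∀ a b → lookup τ a <ᶠ lookup τ b →
    lookup π (lookup (i ∷ j ∷ k ∷ []) a) <ᶠ lookup π (lookup (i ∷ j ∷ k ∷ []) b)) →
  Occurrence τ π (i ∷ j ∷ k ∷ [])
occurrence τ π {i} {j} {k} i<j j<k inj mono = increasing , (λ a b → mono a b , reflect a b)
  where
  v = i ∷ j ∷ k ∷ []
  increasing : ∀ a b → a <ᶠ b → lookup v a <ᶠ lookup v b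
  increasing 0F 1F _ = i<j
  increasing 0F 2F _ = ℕ.<-trans i<j j<k
  increasing 1F 2F _ = j<k
  increasing 1F 1F (s≤s ())
  increasing 2F 1F (s≤s ())
  increasing 2F 2F (s≤s (s≤s ()))
  reflect : ∀ a b → lookup π (lookup v a) <ᶠ lookup π (lookup v b) → lookup τ a <ᶠ lookup τ b
  reflect a b π< with <ᶠ-cmp (lookup τ a) (lookup τ b)
  ... | tri< τ< _ _ = τ<
  ... | tri≈ _ τ≡ _ with ≡.refl ← inj a b τ≡ = contradiction π< (ℕ.<-irrefl ≡.refl)
  ... | tri> _ _ τ> = contradiction (mono b a τ>) (ℕ.<-asym π<)

avoids321 : ∀ {n} (π : Vec (Fin n) n) → Avoids p321 π ⇔ AllTriples No321 (encode π)
avoids321 π = mk⇔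
  (λ av → Equivalence.from (AllTriples-encode π) (λ i j k i<j j<k (z<y , y<x) →
    av ((i ∷ j ∷ k ∷ []) , occurrence p321 π i<j j<k inj (λ where
      1F 0F _ → y<x
      2F 0F _ → ℕ.<-trans z<y y<x
      2F 1F _ → z<y
      0F 0F (s≤s (s≤s ()))
      0F 1F (s≤s ())
      1F 1F (s≤s ())
      0F 2F ()
      1F 2F ()
      2F 2F ()))))
  (λ ts (v , inc , iso) → Equivalence.to (AllTriples-encode {R = No321} π) ts _ _ _ (inc 0F 1F (s≤s z≤n)) (inc 1F 2F (s≤s (s≤s z≤n)))
    (proj₁ (iso 2F 1F) (s≤s z≤n) , proj₁ (iso 1F 0F) (s≤s (s≤s z≤n))))
  where
  inj : ∀ a b → lookup p321 a ≡ lookup p321 b → a ≡ b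
  inj 0F 0F _ = ≡.refl
  inj 0F 1F ()
  inj 0F 2F ()
  inj 1F 2F ()
  inj 1F 1F _ = ≡.refl
  inj 2F 2F _ = ≡.refl

avoids231 : ∀ {n} (π : Vec (Fin n) n) → Avoids p231 π ⇔ AllTriples No231 (encode π)
avoids231 π = mk⇔
  (λ av → Equivalence.from (AllTriples-encode π) (λ i j k i<j j<k (z<x , x<y) →
    av ((i ∷ j ∷ k ∷ []) , occurrence p231 π i<j j<k inj (λ where
      0F 1F _ → x<y
      2F 0F _ → z<x
      2F 1F _ → ℕ.<-trans z<x x<y
      0F 0F (s≤s ())
      1F 0F (s≤s ())
      1F 1F (s≤s (s≤s ()))
      0F 2F ()
      1F 2F ()
      2F 2F ()))))
  (λ ts (v , inc , iso) → Equivalence.to (AllTriples-encode {R = No231} π) ts _ _ _ (inc 0F 1F (s≤s z≤n)) (inc 1F 2F (s≤s (s≤s z≤n)))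
    (proj₁ (iso 2F 0F) (s≤s z≤n) , proj₁ (iso 0F 1F) (s≤s (s≤s z≤n))))
  where
  inj : ∀ a b → lookup p231 a ≡ lookup p231 b → a ≡ b
  inj 0F 0F _ = ≡.refl
  inj 0F 1F ()
  inj 0F 2F ()
  inj 1F 2F ()
  inj 1F 1F _ = ≡.refl
  inj 2F 2F _ = ≡.refl

-- Statistics counted over positions, read off the word

sumTo : ℕ → (ℕ → ℕ) → ℕ
sumTo zero    f = 0
sumTo (suc n) f = f 0 +ℕ sumTo n (f ∘ suc)

sumTo-cong : ∀ n {f g} → (∀ i → f i ≡ g i) → sumTo n f ≡ sumTo n g
sumTo-cong zero    f≡g = ≡.refl
sumTo-cong (suc n) f≡g = ≡.cong₂ _+ℕ_ (f≡g 0) (sumTo-cong n (f≡g ∘ suc))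

count-map : ∀ {a b p} {A : Set a} {B : Set b} {P : Pred B p} (P? : Decidable P) (f : A → B) xs →
  count P? (map f xs) ≡ count (P? ∘ f) xs
count-map P? f []       = ≡.refl
count-map P? f (x ∷ xs) with does (P? (f x))
... | true  = ≡.cong suc (count-map P? f xs)
... | false = count-map P? f xs

count-applyUpTo : ∀ {a p} {A : Set a} {P : Pred A p} (P? : Decidable P) (f : ℕ → A) n →
  count P? (applyUpTo f n) ≡ sumTo n (λ i → ⟦ does (P? (f i)) ⟧)
count-applyUpTo P? f zero    = ≡.refl
count-applyUpTo P? f (suc n) with does (P? (f 0))
... | true  = ≡.cong suc (count-applyUpTo P? (f ∘ suc) n)
... | false = count-applyUpTo P? (f ∘ suc) n

count-cartesianProduct : ∀ {p} {P : Pred (ℕ × ℕ) p} (P? : Decidable P) (f : ℕ → ℕ) n ys →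
  count P? (cartesianProduct (applyUpTo f n) ys) ≡ sumTo n (λ i → count (λ y → P? (f i , y)) ys)
count-cartesianProduct P? f zero    ys = ≡.refl
count-cartesianProduct P? f (suc n) ys = begin
  length (filter P? (map (f 0 ,_) ys ++ rest))      ≡⟨ ≡.cong length (filter-++ P? (map (f 0 ,_) ys) rest) ⟩
  length (filter P? (map (f 0 ,_) ys) ++ filter P? rest) ≡⟨ length-++ (filter P? (map (f 0 ,_) ys)) ⟩
  count P? (map (f 0 ,_) ys) +ℕ count P? rest       ≡⟨ ≡.cong₂ _+ℕ_ (count-map P? (f 0 ,_) ys) (count-cartesianProduct P? (f ∘ suc) n ys) ⟩
  sumTo (suc n) (λ i → count (λ y → P? (f i , y)) ys) ∎
  where
  open ≡.≡-Reasoning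
  rest = cartesianProduct (applyUpTo (f ∘ suc) n) ys

count-square : ∀ {p} {P : Pred (ℕ × ℕ) p} (P? : Decidable P) n →
  count P? (cartesianProduct [1⋯ n ] [1⋯ n ]) ≡ sumTo n (λ i → sumTo n (λ j → ⟦ does (P? (suc i , suc j)) ⟧))
count-square P? n = ≡.trans (count-cartesianProduct P? suc n [1⋯ n ])
  (sumTo-cong n (λ i → count-applyUpTo (λ y → P? (suc i , y)) suc n))

tally-letters : ∀ {m l} p (w : Vec (Fin m) l) → sumTo l (λ j → ⟦ p (letter w j) ⟧) ≡ tally (p ∘ suc) (encode w)
tally-letters p []      = ≡.refl
tally-letters p (x ∷ w) = ≡.cong (_ +ℕ_) (tally-letters p w)

wex-encode : ∀ {n} (π : Vec (Fin n) n) → wex π ≡ wexFrom 0 (encode π)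
wex-encode {n} π = ≡.trans (count-applyUpTo (λ i → i ℕ.≤? π ⟨ i ⟩) suc n) (go 0 π)
  where
  go : ∀ {m l} k (w : Vec (Fin m) l) → sumTo l (λ i → ⟦ does (suc (k +ℕ i) ℕ.≤? letter w i) ⟧) ≡ wexFrom k (encode w)
  go k []      = ≡.refl
  go {l = suc l} k (x ∷ w) = ≡.cong₂ _+ℕ_
    (≡.cong (λ i → ⟦ i <ᵇ suc (toℕ x) ⟧) (ℕ.+-identityʳ k))
    (≡.trans (sumTo-cong l (λ i → ≡.cong (λ j → ⟦ j <ᵇ letter w i ⟧) (ℕ.+-suc k i))) (go (suc k) w))

inv-encode : ∀ {n} (π : Vec (Fin n) n) → inv π ≡ inversions (encode π)
inv-encode {n} π = ≡.trans (count-square (λ (i , j) → (i ℕ.<? j) ×-dec (π ⟨ j ⟩ ℕ.<? π ⟨ i ⟩)) n) (go π)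
  where
  go : ∀ {m l} (w : Vec (Fin m) l) →
    sumTo l (λ i → sumTo l (λ j → ⟦ (i <ᵇ j) ∧ (letter w j <ᵇ letter w i) ⟧)) ≡ inversions (encode w)
  go []      = ≡.refl
  -- The test `i < j` fails throughout column 0, so that column vanishes by computation and the
  -- square loses its first row and column.
  go (x ∷ w) = ≡.cong₂ _+ℕ_ (tally-letters (_<ᵇ suc (toℕ x)) w) (go w)

des-encode : ∀ {n} (π : Vec (Fin (suc n)) (suc n)) → des π ≡ descents (encode π)
des-encode {n} π = ≡.trans (count-applyUpTo (λ i → π ⟨ i +ℕ 1 ⟩ ℕ.<? π ⟨ i ⟩) suc n) (go π)
  where
  go : ∀ {m l} (w : Vec (Fin m) (suc l)) → sumTo l (λ i → ⟦ letter w (i +ℕ 1) <ᵇ letter w i ⟧) ≡ descents (encode w)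
  go (x ∷ [])    = ≡.refl
  go (x ∷ y ∷ w) = ≡.cong (_ +ℕ_) (go (y ∷ w))

vinc-encode : ∀ {n} (π : Vec (Fin n) n) → vinc13-2 π ≡ vincular (encode π)
vinc-encode {n} π = ≡.trans
  (count-square (λ (i , j) → (i +ℕ 1 ℕ.<? j) ×-dec (π ⟨ i ⟩ ℕ.<? π ⟨ j ⟩) ×-dec (π ⟨ j ⟩ ℕ.<? π ⟨ i +ℕ 1 ⟩)) n) (go π)
  where
  go : ∀ {m l} (w : Vec (Fin m) l) →
    sumTo l (λ i → sumTo l (λ j → ⟦ (i +ℕ 1 <ᵇ j) ∧ ((letter w i <ᵇ letter w j) ∧ (letter w j <ᵇ letter w (i +ℕ 1))) ⟧))
    ≡ vincular (encode w)
  go []          = ≡.refl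
  go (x ∷ [])    = ≡.refl
  go (x ∷ y ∷ w) = ≡.cong₂ _+ℕ_ (tally-letters (λ z → (suc (toℕ x) <ᵇ z) ∧ (z <ᵇ suc (toℕ y))) w) (go (y ∷ w))

dd-encode : ∀ {n} (π : Vec (Fin n) n) → dd* π ≡ doubleDescents true (encode π)
dd-encode {n} π = ≡.trans (count-applyUpTo (λ i → (π ⟨ i ⟩ ℕ.<? π ⟨ i ∸ 1 ⟩) ×-dec (π ⟨ i +ℕ 1 ⟩ ℕ.<? π ⟨ i ⟩)) suc n) (first π)
  where
  rest : ∀ {m l} p (w : Vec (Fin m) l) →
    sumTo l (λ i → ⟦ (letter w i <ᵇ letter (p ∷ w) i) ∧ (letter w (i +ℕ 1) <ᵇ letter w i) ⟧)
    ≡ doubleDescents (letter w 0 <ᵇ suc (toℕ p)) (encode w)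
  rest p []          = ≡.refl
  -- Past the end `letter` returns m + 1, above every letter, so the last letter is no double
  -- descent.
  rest {m} p (x ∷ [])    rewrite <ᵇ-false {m} {toℕ x} (ℕ.<-asym (toℕ<n x)) with toℕ x <ᵇ toℕ p
  ... | true  = ≡.refl
  ... | false = ≡.refl
  rest p (x ∷ y ∷ w) = ≡.cong (_ +ℕ_) (rest x (y ∷ w))
  first : ∀ {n} (π : Vec (Fin n) n) →
    sumTo n (λ i → ⟦ (letter π i <ᵇ π ⟨ i ⟩) ∧ (letter π (i +ℕ 1) <ᵇ letter π i) ⟧) ≡ doubleDescents true (encode π)
  first []              = ≡.refl
  first (0F ∷ [])        = ≡.refl
  first {suc n} (x ∷ y ∷ w) rewrite <ᵇ-true (toℕ<n x) = ≡.cong (_ +ℕ_) (rest x (y ∷ w))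

-- Equality of the two sequences and return to the stated sums

module Assembly {c ℓ} (R : CommutativeRing c ℓ) (t q : CommutativeRing.Carrier R) where
  open CommutativeRing R hiding (zero)
  open SumsAndPowers R
  open Sums R
  open Paths R t q
  open Patterns231 R t q
  open Patterns321 R t q
  open import Relation.Binary.Reasoning.Setoid setoid
  open import Algebra.Properties.Semiring.Exp semiring using (^-homo-*; ^-congʳ)
  open import Algebra.Solver.Ring.NaturalCoefficients.Default commutativeSemiring using (solve; _:=_; _:+_; _:*_; con)

  F≈total : ∀ n → F (suc n) 0 ≈ total (suc n)
  F≈total = <-rec _ λ where
    zero          _  → trans F-one (sym total-one)
    (suc zero)    ih → trans F-two (trans (*-congˡ (ih (s≤s z≤n))) (sym total-two))
    (suc (suc n)) ih → begin
      F (suc (suc (suc n))) 0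
        ≈⟨ F-convolution n ⟩
      (q + t) * F (suc (suc n)) 0 + ∑ (antidiagonal n) (λ (a , b) → q ^ suc (suc b) * (F (suc a) 0 * F (suc b) 0))
        ≈⟨ +-cong (*-congˡ (ih ℕ.≤-refl)) (∑-cong-∈ (antidiagonal n) (λ {(a , b)} p → *-congˡ (*-cong
             (ih (s≤s (ℕ.m≤n⇒m≤1+n (≡.subst (a ≤_) (antidiagonal-sum n p) (ℕ.m≤m+n a b)))))
             (ih (s≤s (ℕ.m≤n⇒m≤1+n (≡.subst (b ≤_) (antidiagonal-sum n p) (ℕ.m≤n+m b a)))))))) ⟩
      (q + t) * total (suc (suc n)) + ∑ (antidiagonal n) (λ (a , b) → q ^ suc (suc b) * (total (suc a) * total (suc b)))
        ≈⟨ total-convolution n ⟨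
      total (suc (suc (suc n))) ∎

  ∑-tabulate : ∀ {a} {A : Set a} n (h : Fin n → A) f g → (∀ i → f (h i) ≈ g (toℕ i)) → ∑ (tabulate h) f ≈ ∑ (upTo n) g
  ∑-tabulate zero    h f g eq = refl
  ∑-tabulate (suc n) h f g eq = trans (+-cong (eq fzero) (∑-tabulate n (h ∘ fsuc) f (g ∘ suc) (eq ∘ fsuc))) (sym (∑<-suc n g))

  ∑-words : ∀ m l g → ∑ (words m l) (g ∘ encode) ≈ ∑ (wordsℕ m l) g
  ∑-words m zero    g = refl
  ∑-words m (suc l) g = begin
    ∑ (words m (suc l)) (g ∘ encode)
      ≈⟨ ∑-cartesianProductWith _∷_ (allFin m) (words m l) _ ⟩
    ∑ (allFin m) (λ x → ∑ (words m l) (λ w → g (toℕ x ∷ encode w)))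
      ≈⟨ ∑-tabulate m id _ _ (λ x → ∑-words m l (g ∘ (toℕ x ∷_))) ⟩
    ∑ (upTo m) (λ x → ∑ (wordsℕ m l) (g ∘ (x ∷_)))
      ≈⟨ ∑-wordsℕ-suc m l g ⟨
    ∑ (wordsℕ m (suc l)) g ∎

  ∑-𝔖 : ∀ n (τ : Vec (Fin 3) 3) f →
    ∑ (𝔖 n τ) f ≈ ∑ (words n n) (λ π → [ AllPairsV.allPairs? (λ x y → ¬? (x ≟ᶠ y)) π ×-dec avoids? τ π ] * f π)
  ∑-𝔖 n τ f = begin
    ∑ (𝔖 n τ) f
      ≈⟨ ∑-filter (avoids? τ) (permutations n) f ⟩
    ∑ (permutations n) (λ π → [ avoids? τ π ] * f π)
      ≈⟨ ∑-filter unique (words n n) _ ⟩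
    ∑ (words n n) (λ π → [ unique π ] * ([ avoids? τ π ] * f π))
      ≈⟨ ∑-cong (words n n) (λ π → trans (sym (*-assoc _ _ _)) (*-congʳ (sym (ι-∧ (does (unique π)) _)))) ⟩
    ∑ (words n n) (λ π → [ unique π ×-dec avoids? τ π ] * f π) ∎
    where unique = AllPairsV.allPairs? (λ x y → ¬? (x ≟ᶠ y))

  ∑-321 : ∀ n → ∑ (𝔖 n p321) (λ π → t ^ wex π * q ^ inv π) ≈ F n 0
  ∑-321 n = begin
    ∑ (𝔖 n p321) (λ π → t ^ wex π * q ^ inv π)
      ≈⟨ ∑-𝔖 n p321 _ ⟩
    ∑ (words n n) (λ π → [ AllPairsV.allPairs? (λ x y → ¬? (x ≟ᶠ y)) π ×-dec avoids? p321 π ] * (t ^ wex π * q ^ inv π))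
      ≈⟨ ∑-cong (words n n) (λ π → trans
           (*-congʳ ([]-⇔ (valid⇔ π) (AllPairsV.allPairs? (λ x y → ¬? (x ≟ᶠ y)) π ×-dec avoids? p321 π) (valid321? 0 (encode π))))
           ([]-cong (valid321? 0 (encode π)) (λ valid → *-cong (^-congʳ t (wex≡ π valid)) (^-congʳ q (inv-encode π))))) ⟩
    ∑ (words n n) (W 0 ∘ encode)
      ≈⟨ ∑-words n n (W 0) ⟩
    ∑ (wordsℕ n n) (W 0)
      ≈⟨ ∑-W n 0 z≤n ⟩
    F n 0 ∎
    where
    increasing-below-zero : ∀ w → AllPairs (No321 0) w
    increasing-below-zero []      = []
    increasing-below-zero (x ∷ w) = All.universal (λ { _ (_ , ()) }) w ∷ increasing-below-zero w
    valid⇔ : ∀ π → (AllPairsV _≢_ π × Avoids p321 π) ⇔ Valid321 0 (encode π)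
    valid⇔ π = mk⇔
      (λ (u , av) → Equivalence.to (unique-encode π) u , increasing-below-zero (encode π) , Equivalence.to (avoids321 π) av)
      (λ (u , _ , av) → Equivalence.from (unique-encode π) u , Equivalence.from (avoids321 π) av)
    wex≡ : ∀ π → Valid321 0 (encode π) → wex π ≡ lrMaxima 0 (encode π)
    wex≡ π valid = ≡.trans (wex-encode π) (wexFrom≡lrMaxima [] (encode π) [] [] (inj₁ ≡.refl) [] (encode-< π)
      (All.universal (λ _ → []) _) (length-encode π) valid)

  ∑<-delta : ∀ {n d} (f : ℕ → Carrier) → d < n → ∑ (upTo n) (λ k → [ d ℕ.≟ k ] * f k) ≈ f d
  ∑<-delta {suc n} {zero} f _ = begin
    ∑ (upTo (suc n)) (λ k → [ 0 ℕ.≟ k ] * f k)       ≈⟨ ∑<-suc n _ ⟩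
    1# * f 0 + ∑ (upTo n) (λ k → 0# * f (suc k))     ≈⟨ +-cong (*-identityˡ _) (trans (∑-cong (upTo n) (λ k → zeroˡ (f (suc k)))) (∑-zero (upTo n))) ⟩
    f 0 + 0#                                         ≈⟨ +-identityʳ _ ⟩
    f 0                                              ∎
  ∑<-delta {suc n} {suc d} f (s≤s d<n) = begin
    ∑ (upTo (suc n)) (λ k → [ suc d ℕ.≟ k ] * f k)              ≈⟨ ∑<-suc n _ ⟩
    0# * f 0 + ∑ (upTo n) (λ k → [ d ℕ.≟ k ] * f (suc k))       ≈⟨ +-cong (zeroˡ _) (∑<-delta (f ∘ suc) d<n) ⟩
    0# + f (suc d)                                              ≈⟨ +-identityˡ _ ⟩
    f (suc d)                                                   ∎

  module _ (q⁻¹ : Carrier) (inverse : q * q⁻¹ ≈ 1#) where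

    clear-denominator : ∀ e → q ^ e * (1# + t * q⁻¹) ^ e ≈ (q + t) ^ e
    clear-denominator zero    = *-identityˡ 1#
    clear-denominator (suc e) = begin
      q * q ^ e * ((1# + t * q⁻¹) * (1# + t * q⁻¹) ^ e)
        ≈⟨ solve 5 (λ q p t r x → q :* p :* ((con 1 :+ t :* r) :* x) := (q :+ t :* (q :* r)) :* (p :* x))
             refl q (q ^ e) t q⁻¹ ((1# + t * q⁻¹) ^ e) ⟩
      (q + t * (q * q⁻¹)) * (q ^ e * (1# + t * q⁻¹) ^ e)
        ≈⟨ *-cong (+-congˡ (trans (*-congˡ inverse) (*-identityʳ t))) (clear-denominator e) ⟩
      (q + t) * (q + t) ^ e ∎

    coefficient : ℕ → ℕ → Carrier
    coefficient n k = q ^ (n ∸ suc k) * t ^ suc k * (1# + t * q⁻¹) ^ (n +ℕ 1 ∸ 2 *ℕ suc k)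

    -- Writing the length as 2d + 1 + e by `descents-bound`, the two exponents at k = d + 1 are d +
    -- e and e; q^e clears the denominators. The bound ensures that the range of k reaches d + 1.
    coefficient-weight : ∀ w n → length w ≡ suc n → Valid231 w →
      q ^ vincular w * coefficient (suc n) (descents w) ≈ weight231 w × descents w < ⌊ suc n +ℕ 1 /2⌋
    coefficient-weight (x ∷ w) n len (_ , _ , dd) with descents-bound x w dd
    ... | e , len-w = weights , bound
      where
      d = descents (x ∷ w)
      n≡ : n ≡ d +ℕ d +ℕ e
      n≡ = ≡.trans (≡.sym (ℕ.suc-injective len)) len-w
      e₁ : suc n ∸ suc d ≡ d +ℕ e
      e₁ = ≡.trans (≡.cong (_∸ d) (≡.trans n≡ (ℕ.+-assoc d d e))) (ℕ.m+n∸m≡n d (d +ℕ e))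
      arith : ∀ d e → suc (d +ℕ d +ℕ e) +ℕ 1 ≡ 2 *ℕ suc d +ℕ e
      arith = solve-∀
      n+1≡ : suc n +ℕ 1 ≡ 2 *ℕ suc d +ℕ e
      n+1≡ = ≡.trans (≡.cong (λ k → suc k +ℕ 1) n≡) (arith d e)
      e₂ : suc n +ℕ 1 ∸ 2 *ℕ suc d ≡ e
      e₂ = ≡.trans (≡.cong (_∸ 2 *ℕ suc d) n+1≡) (ℕ.m+n∸m≡n (2 *ℕ suc d) e)
      weights : q ^ vincular (x ∷ w) * coefficient (suc n) d ≈ weight231 (x ∷ w)
      weights = begin
        q ^ vincular (x ∷ w) * (q ^ (suc n ∸ suc d) * t ^ suc d * (1# + t * q⁻¹) ^ (suc n +ℕ 1 ∸ 2 *ℕ suc d))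
          ≈⟨ *-congˡ (*-cong (*-congʳ (trans (^-congʳ q e₁) (^-homo-* q d e))) (^-congʳ (1# + t * q⁻¹) e₂)) ⟩
        q ^ vincular (x ∷ w) * (q ^ d * q ^ e * t ^ suc d * (1# + t * q⁻¹) ^ e)
          ≈⟨ solve 5 (λ v a b s r → v :* (a :* b :* s :* r) := s :* a :* (b :* r) :* v) refl _ _ _ _ _ ⟩
        t ^ suc d * q ^ d * (q ^ e * (1# + t * q⁻¹) ^ e) * q ^ vincular (x ∷ w)
          ≈⟨ *-congʳ (*-congˡ (clear-denominator e)) ⟩
        t ^ suc d * q ^ d * (q + t) ^ e * q ^ vincular (x ∷ w)
          ≈⟨ weight231-value (x ∷ w) ≡.refl (≡.cong suc len-w) ≡.refl ⟨
        weight231 (x ∷ w) ∎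
      bound : d < ⌊ suc n +ℕ 1 /2⌋
      bound = ≡.subst (_≤ ⌊ suc n +ℕ 1 /2⌋) (≡.sym (ℕ.n≡⌊n+n/2⌋ (suc d)))
        (ℕ.⌊n/2⌋-mono (≡.subst (suc d +ℕ suc d ≤_) (≡.sym n+1≡)
          (ℕ.≤-trans (ℕ.≤-reflexive (≡.cong (suc d +ℕ_) (≡.sym (ℕ.+-identityʳ (suc d))))) (ℕ.m≤m+n (2 *ℕ suc d) e))))

    -- The sum over k is moved inside the sum over words, where the condition on `des` selects the
    -- single value k = d + 1.
    ∑-231 : ∀ n →
      ∑ [1⋯ ⌊ suc n +ℕ 1 /2⌋ ] (λ k →
        (q ^ (suc n ∸ k) * ∑ (𝔖~231 (suc n) (k ∸ 1)) (λ π → q ^ vinc13-2 π))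
          * t ^ k * (1# + t * q⁻¹) ^ (suc n +ℕ 1 ∸ 2 *ℕ k))
      ≈ total (suc n)
    ∑-231 n = begin
      ∑ [1⋯ K ] _
        ≈⟨ ∑-applyUpTo suc K _ ⟩
      ∑ (upTo K) (λ k → (q ^ (N ∸ suc k) * ∑ (𝔖~231 N k) (λ π → q ^ vinc13-2 π)) * t ^ suc k * (1# + t * q⁻¹) ^ (N +ℕ 1 ∸ 2 *ℕ suc k))
        ≈⟨ ∑-cong (upTo K) (λ k → trans
             (solve 4 (λ a s b r → a :* s :* b :* r := s :* (a :* b :* r)) refl _ _ _ _)
             (trans (*-congʳ (inner k)) (sym (∑-*ʳ Π _ _)))) ⟩
      ∑ (upTo K) (λ k → ∑ Π (λ π → [ valid? π ] * ([ descents (encode π) ℕ.≟ k ] * q ^ vincular (encode π)) * coefficient N k))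
        ≈⟨ ∑-comm (upTo K) Π _ ⟩
      ∑ Π (λ π → ∑ (upTo K) (λ k → [ valid? π ] * ([ descents (encode π) ℕ.≟ k ] * q ^ vincular (encode π)) * coefficient N k))
        ≈⟨ ∑-cong Π (λ π → trans
             (∑-cong (upTo K) (λ k → solve 4 (λ i j v c → i :* (j :* v) :* c := i :* (j :* (v :* c))) refl _ _ _ _))
             (trans (∑-*ˡ (upTo K) _ _) ([]-cong (valid? π) (collapse π)))) ⟩
      ∑ Π (G ∘ encode)
        ≈⟨ ∑-words N N G ⟩
      total N ∎
      where
      N = suc n
      K = ⌊ N +ℕ 1 /2⌋
      Π = words N N
      valid? : (π : Vec (Fin N) N) → Dec (Valid231 (encode π))
      valid? π = valid231? (encode π)
      collapse : ∀ π → Valid231 (encode π) →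
        ∑ (upTo K) (λ k → [ descents (encode π) ℕ.≟ k ] * (q ^ vincular (encode π) * coefficient N k)) ≈ weight231 (encode π)
      collapse π valid with coefficient-weight (encode π) n (length-encode π) valid
      ... | weights , bound = trans (∑<-delta _ bound) weights
      unique : (π : Vec (Fin N) N) → Dec (AllPairsV _≢_ π)
      unique = AllPairsV.allPairs? (λ x y → ¬? (x ≟ᶠ y))
      inner : ∀ k → ∑ (𝔖~231 N k) (λ π → q ^ vinc13-2 π) ≈
        ∑ Π (λ π → [ valid? π ] * ([ descents (encode π) ℕ.≟ k ] * q ^ vincular (encode π)))
      inner k = begin
        ∑ (𝔖~231 N k) (λ π → q ^ vinc13-2 π)
          ≈⟨ ∑-filter (λ π → (dd* π ℕ.≟ 0) ×-dec (des π ℕ.≟ k)) (𝔖 N p231) _ ⟩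
        ∑ (𝔖 N p231) (λ π → [ (dd* π ℕ.≟ 0) ×-dec (des π ℕ.≟ k) ] * q ^ vinc13-2 π)
          ≈⟨ ∑-𝔖 N p231 _ ⟩
        ∑ Π (λ π → [ unique π ×-dec avoids? p231 π ] * ([ (dd* π ℕ.≟ 0) ×-dec (des π ℕ.≟ k) ] * q ^ vinc13-2 π))
          ≈⟨ ∑-cong Π (λ π → begin
               [ unique π ×-dec avoids? p231 π ] * ([ (dd* π ℕ.≟ 0) ×-dec (des π ℕ.≟ k) ] * q ^ vinc13-2 π)
                 ≈⟨ *-assoc _ _ _ ⟨
               [ unique π ×-dec avoids? p231 π ] * [ (dd* π ℕ.≟ 0) ×-dec (des π ℕ.≟ k) ] * q ^ vinc13-2 π
                 ≈⟨ *-cong (trans (sym (ι-∧ (does (unique π ×-dec avoids? p231 π)) _))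
                      ([]-⇔ (valid⇔ π) ((unique π ×-dec avoids? p231 π) ×-dec ((dd* π ℕ.≟ 0) ×-dec (des π ℕ.≟ k)))
                        (valid? π ×-dec (descents (encode π) ℕ.≟ k))))
                      (^-congʳ q (vinc-encode π)) ⟩
               [ valid? π ×-dec (descents (encode π) ℕ.≟ k) ] * q ^ vincular (encode π)
                 ≈⟨ trans (*-congʳ (ι-∧ (does (valid? π)) _)) (*-assoc _ _ _) ⟩
               [ valid? π ] * ([ descents (encode π) ℕ.≟ k ] * q ^ vincular (encode π)) ∎) ⟩
        ∑ Π (λ π → [ valid? π ] * ([ descents (encode π) ℕ.≟ k ] * q ^ vincular (encode π))) ∎
        where
        valid⇔ : ∀ π → ((AllPairsV _≢_ π × Avoids p231 π) × (dd* π ≡ 0 × des π ≡ k)) ⇔ (Valid231 (encode π) × descents (encode π) ≡ k)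
        valid⇔ π = mk⇔
          (λ ((u , av) , (dd , d)) →
            (Equivalence.to (unique-encode π) u , Equivalence.to (avoids231 π) av , ≡.trans (≡.sym (dd-encode π)) dd) ,
            ≡.trans (≡.sym (des-encode π)) d)
          (λ ((u , av , dd) , d) →
            (Equivalence.from (unique-encode π) u , Equivalence.from (avoids231 π) av) ,
            (≡.trans (dd-encode π) dd , ≡.trans (des-encode π) d))

theorem4p3 : ∀ {c ℓ : Level} (R : CommutativeRing c ℓ) →
    let open CommutativeRing R
        open SumsAndPowers R
    in
    (t q q⁻¹ : Carrier) → q * q⁻¹ ≈ 1# →
    (n : ℕ) → 1 ≤ n →
    ∑ (𝔖 n p321) (λ π → t ^ wex π * q ^ inv π)
      ≈
    ∑ [1⋯ ⌊ n +ℕ 1 /2⌋ ] (λ k →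
      (q ^ (n ∸ k) * ∑ (𝔖~231 n (k ∸ 1)) (λ π → q ^ vinc13-2 π))
        * t ^ k * (1# + t * q⁻¹) ^ (n +ℕ 1 ∸ 2 *ℕ k))
theorem4p3 R t q q⁻¹ inverse (suc n) _ =
  trans (∑-321 (suc n)) (trans (F≈total n) (sym (∑-231 q⁻¹ inverse n)))
  where
  open CommutativeRing R using (trans; sym)
  open Assembly R t q
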